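{- Let $n\ge 1$ and let $\alpha_1,\dots,\alpha_n$ be infinite ordinals with Cantor normal forms without multiplicities $\alpha_i=\sum_{j<l_i}\omega^{\alpha_{i,j}}$, $\alpha_{i,0}\ge\alpha_{i,1}\ge\dots\ge\alpha_{i,l_i-1}$. Let $X=\alpha_1\times\dots\times\alpha_n$, let $Sl(X)=\{0,\dots,l_1-1\}\times\dots\times\{0,\dots,l_n-1\}$ and $Gr(X)=\{s\in Sl(X): s(k)=0 \text{ for some } k\in[1,n]\}$. For $s\in Sl(X)$ let $X_s=\omega^{\alpha_{1,s(1)}}\times\dots\times\omega^{\alpha_{n,s(n)}}$. Then $$\mathbf{w}(X)=\bigoplus_{s\in Gr(X)}\mathbf{w}(X_s).$$
   Context: Products of ordinals have the componentwise order. The width $\mathbf{w}(A)$ of a wqo $A$ is the rank of the forest of nonempty finite sequences of pairwise incomparable elements of $A$ ordered by initial segment. $\oplus$ is the natural (Hessenberg) sum. ($X_s$ is isomorphic to the "slice" of $X$ consisting of tuples whose $i$-th coordinate lies in $[\sum_{j<s(i)}\omega^{\alpha_{i,j}},\sum_{j\le s(i)}\omega^{\alpha_{i,j}})$.) -}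

module Defs where

open import Axiom.ExcludedMiddle using (ExcludedMiddle)
open import Data.Empty using (⊥-elim)
open import Data.Fin.Base as Fin using (Fin; toℕ)
open import Data.Fin.Properties using (any?; ∀-cons)
open import Data.List.Base using (List; []; _∷_; _++_; foldr; filter; cartesianProductWith; allFin)
open import Data.List.Membership.Propositional using (_∈_)
open import Data.List.Membership.Propositional.Properties using (∈-++⁺ˡ; ∈-++⁺ʳ)
open import Data.List.Relation.Unary.All as All using ()
open import Data.List.Relation.Unary.AllPairs using (AllPairs; []; _∷_)
open import Data.List.Relation.Unary.Any using (here; there)
open import Data.Maybe.Base using (Maybe; just; nothing)
open import Data.Nat.Base as ℕ using (ℕ; zero; suc)
import Data.Nat.Properties as ℕ
open import Data.Product.Base using (Σ-syntax; ∃-syntax; ∃₂; _×_; _,_; proj₁; proj₂; swap)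
open import Data.Sum.Base using (_⊎_; inj₁; inj₂; [_,_]′)
import Data.Vec.Functional as Vector
open import Function.Base using (_∘_)
open import Induction.WellFounded using (WellFounded; Acc; acc)
open import Level using (Level; Setω; Lift; lower; _⊔_) renaming (suc to lsuc)
open import Relation.Binary.Bundles using (Preorder)
open import Relation.Binary.Core using (Rel)
open import Relation.Binary.Definitions using (Reflexive; Transitive)
open import Relation.Binary.PropositionalEquality as ≡ using (_≡_; _≢_; subst)
open import Relation.Nullary using (¬_; yes; no)
open import Relation.Unary using (Decidable)

private
  variable
    c r ℓ ℓ₁ ℓ₂ : Level

-- The ambient classical logic.  Since `Σ` is a strong sum, this also yields
-- all the choice principles needed for ordinal and wqo theory.
EM : Setω
EM = ∀ {ℓ} → ExcludedMiddle ℓ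

------------------------------------------------------------------------
-- Ordinals

-- `lsub I f` is the least ordinal strictly greater than every `f i`.
-- Two codes denote the same ordinal when they are related by `_≈ₒ_`.
data Ord ℓ : Set (lsuc ℓ) where
  lsub : (I : Set ℓ) → (I → Ord ℓ) → Ord ℓ

infix 4 _≤ₒ_ _<ₒ_ _≈ₒ_

mutual
  _≤ₒ_ : Rel (Ord ℓ) ℓ
  lsub I f ≤ₒ β = ∀ i → f i <ₒ β

  _<ₒ_ : Rel (Ord ℓ) ℓ
  α <ₒ lsub J g = ∃[ j ] α ≤ₒ g j

_≈ₒ_ : Rel (Ord ℓ) ℓ
α ≈ₒ β = α ≤ₒ β × β ≤ₒ α

𝟘 : Ord ℓ
𝟘 = lsub (Lift _ (Fin 0)) λ ()

sucₒ : Ord ℓ → Ord ℓ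
sucₒ α = lsub (Lift _ (Fin 1)) λ _ → α

fromℕ : ℕ → Ord ℓ
fromℕ zero    = 𝟘
fromℕ (suc n) = sucₒ (fromℕ n)

ω : Ord ℓ
ω = lsub (Lift _ ℕ) (fromℕ ∘ lower)

infixl 6 _+ₒ_ _⊕_
infixl 7 _·ₒ_

-- The least strict upper bound of { α′ : α′ < α } ∪ { α + β′ : β′ < β };
-- here and below it suffices to let α′ and β′ range over cofinal families.
_+ₒ_ : Ord ℓ → Ord ℓ → Ord ℓ
lsub I f +ₒ lsub J g = lsub (I ⊎ J) [ f , (λ j → lsub I f +ₒ g j) ]′

_·ₒ_ : Ord ℓ → ℕ → Ord ℓ
α ·ₒ zero  = 𝟘
α ·ₒ suc k = α ·ₒ k +ₒ α

-- ω^ α is the least strict upper bound of { 0 } ∪ { ω^ α′ · k : α′ < α, k < ω }.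
ω^_ : Ord ℓ → Ord ℓ
ω^ lsub I f = lsub (Maybe (I × ℕ)) λ where
  nothing        → 𝟘
  (just (i , k)) → (ω^ f i) ·ₒ k

-- Natural sum: the least strict upper bound of
-- { α′ ⊕ β : α′ < α } ∪ { α ⊕ β′ : β′ < β }.
_⊕_ : Ord ℓ → Ord ℓ → Ord ℓ
lsub I f ⊕ lsub J g =
  lsub (I ⊎ J) [ (λ i → f i ⊕ lsub J g) , (λ j → lsub I f ⊕ g j) ]′

⨁ : List (Ord ℓ) → Ord ℓ
⨁ = foldr _⊕_ 𝟘

-- β 0 + β 1 + … + β (l - 1)
∑ : ∀ {l} → (Fin l → Ord ℓ) → Ord ℓ
∑ = Vector.foldr _+ₒ_ 𝟘

-- `β` lists the exponents, with repetitions, of the Cantor normal form of `α`.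
record IsCNF (α : Ord ℓ) {l : ℕ} (β : Fin l → Ord ℓ) : Set ℓ where
  field
    nonincreasing : ∀ {j k} → j Fin.≤ k → β k ≤ₒ β j
    sum           : α ≈ₒ ∑ (λ j → ω^ β j)

<ₒ⇒≤ₒ : ∀ {α β : Ord ℓ} → α <ₒ β → α ≤ₒ β
<ₒ⇒≤ₒ {α = lsub I f} {β = lsub J g} (j , p) i = j , <ₒ⇒≤ₒ (p i)

≤ₒ-refl : Reflexive (_≤ₒ_ {ℓ})
≤ₒ-refl {x = lsub I f} i = i , ≤ₒ-refl

mutual
  ≤ₒ-trans : Transitive (_≤ₒ_ {ℓ})
  ≤ₒ-trans {i = lsub I f} p q i = <ₒ-≤ₒ-trans (p i) q

  <ₒ-≤ₒ-trans : ∀ {α β γ : Ord ℓ} → α <ₒ β → β ≤ₒ γ → α <ₒ γ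
  <ₒ-≤ₒ-trans {β = lsub J g} {γ = lsub K h} (j , p) q =
    proj₁ (q j) , ≤ₒ-trans p (proj₂ (q j))

<ₒ-wellFounded : WellFounded (_<ₒ_ {ℓ})
<ₒ-wellFounded α = go α ≤ₒ-refl
  where
  go : ∀ (α : Ord ℓ) {β} → β ≤ₒ α → Acc _<ₒ_ β
  go (lsub I f) p = acc λ q → let (i , q′) = <ₒ-≤ₒ-trans q p in go (f i) q′

≤ₒ-or->ₒ : EM → ∀ (α β : Ord ℓ) → α ≤ₒ β ⊎ β <ₒ α
≤ₒ-or->ₒ em (lsub I f) β with em {P = β <ₒ lsub I f}
... | yes β<α = inj₂ β<α
... | no  β≮α = inj₁ λ i → below i (≤ₒ-or->ₒ em β (f i))
  where
  below : ∀ i → β ≤ₒ f i ⊎ f i <ₒ β → f i <ₒ β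
  below i (inj₁ β≤fi) = ⊥-elim (β≮α (i , β≤fi))
  below i (inj₂ fi<β) = fi<β

------------------------------------------------------------------------
-- Well-quasi-orders and their width

record WQO c ℓ₁ ℓ₂ : Set (lsuc (c ⊔ ℓ₁ ⊔ ℓ₂)) where
  field
    preorder : Preorder c ℓ₁ ℓ₂
  open Preorder preorder public
  field
    good : ∀ (x : ℕ → Carrier) → ∃₂ λ i j → i ℕ.< j × x i ≲ x j

module _ (A : WQO c ℓ₁ ℓ₂) where
  open WQO A using (Carrier; _≲_; good)

  Incomparable : Rel Carrier ℓ₂
  Incomparable x y = ¬ x ≲ y × ¬ y ≲ x

  Inc : Set (c ⊔ ℓ₂)
  Inc = Σ[ xs ∈ List Carrier ] xs ≢ [] × AllPairs Incomparable xs

  -- `t ⊐ s`: `s` is a proper initial segment of `t`.  The forest is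
  -- well founded towards longer sequences.
  _⊐_ : Rel Inc c
  t ⊐ s = ∃₂ λ x xs → proj₁ t ≡ proj₁ s ++ x ∷ xs

  rank : ∀ {s} → Acc _⊐_ s → Ord (c ⊔ ℓ₂)
  rank {s} (acc rs) = lsub (∃[ t ] t ⊐ s) λ (t , t⊐s) → rank (rs {t} t⊐s)

  AllPairs-++ : ∀ {R : Rel Carrier r} {x y} xs {ys} →
                AllPairs R (xs ++ y ∷ ys) → x ∈ xs → R x y
  AllPairs-++ (_ ∷ xs) (px ∷ _)  (here ≡.refl) = All.lookup px (∈-++⁺ʳ xs (here ≡.refl))
  AllPairs-++ (_ ∷ xs) (_ ∷ pxs) (there x∈)     = AllPairs-++ xs pxs x∈

  noChain : ∀ (s : ℕ → Inc) → ¬ (∀ k → s (suc k) ⊐ s k)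
  noChain s ext = let (_ , _ , i<j , p) = good new in proj₁ (incomparable i<j) p
    where
    new : ℕ → Carrier
    new k = proj₁ (ext k)

    new∈ : ∀ {i j} → suc i ℕ.≤′ j → new i ∈ proj₁ (s j)
    new∈ {i} ℕ.≤′-refl with ext i
    ... | _ , _ , eq = subst (_ ∈_) (≡.sym eq) (∈-++⁺ʳ (proj₁ (s i)) (here ≡.refl))
    new∈ (ℕ.≤′-step {n} p) with ext n
    ... | _ , _ , eq = subst (_ ∈_) (≡.sym eq) (∈-++⁺ˡ (new∈ p))

    incomparable : ∀ {i j} → i ℕ.< j → Incomparable (new i) (new j)
    incomparable {i} {j} i<j = AllPairs-++ (proj₁ (s j))
      (subst (AllPairs Incomparable) (proj₂ (proj₂ (ext j))) (proj₂ (proj₂ (s (suc j)))))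
      (new∈ (ℕ.≤⇒≤′ i<j))

  ⊐-wellFounded : EM → WellFounded _⊐_
  ⊐-wellFounded em s₀ with em {P = Acc _⊐_ s₀}
  ... | yes p  = p
  ... | no  ¬p = ⊥-elim (noChain (proj₁ ∘ chain) (λ k → proj₁ (proj₂ (next (chain k)))))
    where
    Bad : Set (c ⊔ ℓ₂)
    Bad = ∃[ s ] ¬ Acc _⊐_ s

    next : ((s , _) : Bad) → ∃[ t ] t ⊐ s × ¬ Acc _⊐_ t
    next (s , ¬acc) with em {P = ∃[ t ] t ⊐ s × ¬ Acc _⊐_ t}
    ... | yes q = q
    ... | no ¬q = ⊥-elim (¬acc (acc λ {t} t⊐s → accessible t t⊐s))
      where
      accessible : ∀ t → t ⊐ s → Acc _⊐_ t
      accessible t t⊐s with em {P = Acc _⊐_ t}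
      ... | yes p = p
      ... | no ¬p = ⊥-elim (¬q (t , t⊐s , ¬p))

    chain : ℕ → Bad
    chain zero    = s₀ , ¬p
    chain (suc k) = let (t , _ , ¬acc) = next (chain k) in t , ¬acc

  width : EM → Ord (c ⊔ ℓ₂)
  width em = lsub Inc λ s → rank (⊐-wellFounded em s)

------------------------------------------------------------------------
-- Products of ordinals

-- An ordinal as the set of all smaller ordinals.
Below : Ord ℓ → Set (lsuc ℓ)
Below α = ∃[ ξ ] ξ <ₒ α

module _ {n : ℕ} (α : Fin n → Ord ℓ) where

  Tuple : Set (lsuc ℓ)
  Tuple = ∀ i → Below (α i)

  productPreorder : Preorder (lsuc ℓ) ℓ ℓ
  productPreorder = record
    { Carrier    = Tuple
    ; _≈_        = λ x y → ∀ i → proj₁ (x i) ≈ₒ proj₁ (y i)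
    ; _≲_        = λ x y → ∀ i → proj₁ (x i) ≤ₒ proj₁ (y i)
    ; isPreorder = record
      { isEquivalence = record
        { refl  = λ _ → ≤ₒ-refl , ≤ₒ-refl
        ; sym   = λ p i → swap (p i)
        ; trans = λ p q i → ≤ₒ-trans (proj₁ (p i)) (proj₁ (q i))
                          , ≤ₒ-trans (proj₂ (q i)) (proj₂ (p i))
        }
      ; reflexive = λ p i → proj₁ (p i)
      ; trans     = λ p q i → ≤ₒ-trans (p i) (q i)
      }
    }

StrictlyIncreasing : (ℕ → ℕ) → Set
StrictlyIncreasing φ = ∀ {i j} → i ℕ.< j → φ i ℕ.< φ j

step⇒strict : ∀ {φ} → (∀ k → φ k ℕ.< φ (suc k)) → StrictlyIncreasing φ
step⇒strict {φ} step = λ i<j → go (ℕ.≤⇒≤′ i<j)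
  where
  go : ∀ {i j} → suc i ℕ.≤′ j → φ i ℕ.< φ j
  go ℕ.≤′-refl     = step _
  go (ℕ.≤′-step p) = ℕ.<-trans (go p) (step _)

Nondecreasing : (ℕ → Ord ℓ) → Set ℓ
Nondecreasing f = ∀ {i j} → i ℕ.< j → f i ≤ₒ f j

module _ (em : EM) where

  tailMin : ∀ (f : ℕ → Ord ℓ) N →
            ∃[ m ] N ℕ.≤ m × (∀ k → m ℕ.≤ k → f m ≤ₒ f k)
  tailMin f N = go N ℕ.≤-refl (<ₒ-wellFounded (f N))
    where
    go : ∀ m → N ℕ.≤ m → Acc _<ₒ_ (f m) →
         ∃[ m ] N ℕ.≤ m × (∀ k → m ℕ.≤ k → f m ≤ₒ f k)
    go m N≤m (acc rs) with em {P = ∃[ k ] m ℕ.≤ k × f k <ₒ f m}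
    ... | yes (k , m≤k , fk<fm) = go k (ℕ.≤-trans N≤m m≤k) (rs fk<fm)
    ... | no ¬p = m , N≤m , λ k m≤k →
            [ (λ q → q) , (λ q → ⊥-elim (¬p (k , m≤k , q))) ]′ (≤ₒ-or->ₒ em (f m) (f k))

  subsequence : ∀ (f : ℕ → Ord ℓ) →
                ∃[ φ ] StrictlyIncreasing φ × Nondecreasing (f ∘ φ)
  subsequence f = φ , φ-strict , λ {i} {j} i<j → φ-min i (φ j) (ℕ.<⇒≤ (φ-strict i<j))
    where
    φ : ℕ → ℕ
    φ zero    = proj₁ (tailMin f 0)
    φ (suc k) = proj₁ (tailMin f (suc (φ k)))

    φ-strict : StrictlyIncreasing φ
    φ-strict = step⇒strict λ k → proj₁ (proj₂ (tailMin f (suc (φ k))))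

    φ-min : ∀ i k → φ i ℕ.≤ k → f (φ i) ≤ₒ f k
    φ-min zero    = proj₂ (proj₂ (tailMin f 0))
    φ-min (suc i) = proj₂ (proj₂ (tailMin f (suc (φ i))))

  subsequences : ∀ n (x : ℕ → Fin n → Ord ℓ) →
                 ∃[ φ ] StrictlyIncreasing φ × (∀ i → Nondecreasing (λ k → x (φ k) i))
  subsequences zero    x = (λ k → k) , (λ p → p) , λ ()
  subsequences (suc n) x =
    let (φ , φ< , φ≤) = subsequences n (λ k i → x k (Fin.suc i))
        (ψ , ψ< , ψ≤) = subsequence (λ k → x (φ k) Fin.zero)
    in φ ∘ ψ , φ< ∘ ψ< , λ { Fin.zero → ψ≤ ; (Fin.suc i) → φ≤ i ∘ ψ< }

  -- α 0 × … × α (n - 1) with the componentwise order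
  product : ∀ {n} → (Fin n → Ord ℓ) → WQO (lsuc ℓ) ℓ ℓ
  product {n = n} α = record
    { preorder = productPreorder α
    ; good     = λ x →
        let (φ , φ< , φ≤) = subsequences n (λ k i → proj₁ (x k i))
        in φ 0 , φ 1 , φ< ℕ.z<s , λ i → φ≤ i ℕ.z<s
    }

------------------------------------------------------------------------
-- Slices

Slice : ∀ {n} → (Fin n → ℕ) → Set
Slice l = ∀ i → Fin (l i)

-- Every slice occurs exactly once (up to pointwise equality).
Sl : ∀ {n} (l : Fin n → ℕ) → List (Slice l)
Sl {zero}  l = (λ ()) ∷ []
Sl {suc n} l = cartesianProductWith ∀-cons (allFin (l Fin.zero)) (Sl (l ∘ Fin.suc))

Grounded : ∀ {n} {l : Fin n → ℕ} → Slice l → Set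
Grounded s = ∃[ k ] toℕ (s k) ≡ 0

grounded? : ∀ {n} {l : Fin n → ℕ} → Decidable (Grounded {l = l})
grounded? s = any? λ k → toℕ (s k) ℕ.≟ 0

Gr : ∀ {n} (l : Fin n → ℕ) → List (Slice l)
Gr l = filter grounded? (Sl l)

{-# OPTIONS --safe #-}

-- Upper bound: slices on a common diagonal s, s + 1, s + 2, … are strictly increasing blocks
-- of X, so an antichain meets at most one of them, and all embed in the first, grounded one.
-- Hence X maps into the disjoint sum of the grounded slices preserving incomparability.
--
-- Lower bound: w (X_s) is additively indecomposable, because copies of X_s shifted upwards
-- leave room for the residual of any earlier element.  Fill the grounded slices in order of
-- increasing width, larger slices first among equals.  Whatever finite part has been played,
-- the next slice b has a copy incomparable to it: an element of a slice a ⋠ b is not below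
-- that copy's elements if these are shifted far enough in a coordinate k with a_k = 0, where
-- ω^ α_{k,0} is infinite.  This gives the ordinary sum of the widths, in decreasing order,
-- which for indecomposable ordinals is their natural sum.

module Submission where

open import Defs
open import Data.Empty using (⊥-elim)
open import Data.Fin.Base as Fin using (Fin; zero; suc; toℕ)
open import Data.Fin.Properties using (∀-cons; ¬∀⟶∃¬; toℕ-injective; toℕ-inject₁)
open import Data.List.Base
  using (List; []; _∷_; [_]; _++_; map; reverse; replicate; cartesianProductWith)
open import Data.List.Membership.Propositional using (_∈_)
open import Data.List.Membership.Propositional.Properties using (∈-allFin)
open import Data.List.Properties using (unfold-reverse; ++-assoc)
open import Data.List.Relation.Binary.Permutation.Propositional as Perm
  using (_↭_; ↭-refl; ↭-trans; prep) renaming (swap to ↭-swap)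
open import Data.List.Relation.Binary.Permutation.Propositional.Properties
  using (All-resp-↭) renaming (map⁺ to ↭-map⁺)
open import Data.List.Relation.Unary.All as All using (All; []; _∷_)
import Data.List.Relation.Unary.All.Properties as All
open import Data.List.Relation.Unary.AllPairs as AllPairs using (AllPairs; []; _∷_)
import Data.List.Relation.Unary.AllPairs.Properties as AllPairs
open import Data.List.Relation.Unary.Any as Any using (Any; here; there)
import Data.List.Relation.Unary.Any.Properties as Any
open import Data.Maybe.Base using (just; nothing)
open import Data.Nat.Base as ℕ using (ℕ; zero; suc; _≤_; z≤n; s≤s)
import Data.Nat.Properties as ℕ
open import Data.Product.Base using (∃-syntax; ∃₂; _×_; _,_; proj₁; proj₂; swap)
open import Data.Sum.Base using (_⊎_; inj₁; inj₂; [_,_]′)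
open import Data.Unit.Base using (⊤)
open import Function.Base using (_∘_; id)
open import Induction.WellFounded using (Acc; acc)
open import Level using (Level; Lift; lift; 0ℓ; _⊔_) renaming (suc to lsuc)
open import Relation.Binary.Core using (Rel)
open import Relation.Binary.Definitions using (Symmetric; _Respects₂_; tri<; tri≈; tri>)
open import Relation.Binary.Structures using (IsPreorder)
open import Relation.Binary.PropositionalEquality as ≡
  using (_≡_; _≢_; refl; sym; trans; cong; subst; subst₂)
open import Relation.Nullary using (¬_; yes; no)

private
  variable
    a r c ℓ ℓ₁ ℓ₂ : Level
    α β γ α′ β′ w : Ord ℓ
    l n : ℕ

-- Strict order on ordinals

≤ₒ-<ₒ-trans : α ≤ₒ β → β <ₒ γ → α <ₒ γ
≤ₒ-<ₒ-trans {γ = lsub _ _} p (k , q) = k , ≤ₒ-trans p q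

<ₒ-trans : α <ₒ β → β <ₒ γ → α <ₒ γ
<ₒ-trans p q = ≤ₒ-<ₒ-trans (<ₒ⇒≤ₒ p) q

<ₒ-irrefl : ¬ α <ₒ α
<ₒ-irrefl {α = α} = go (<ₒ-wellFounded α)
  where
  go : ∀ {α : Ord ℓ} → Acc _<ₒ_ α → ¬ α <ₒ α
  go (acc rs) p = go (rs p) p

<ₒ-asym : α <ₒ β → ¬ β <ₒ α
<ₒ-asym p q = <ₒ-irrefl (<ₒ-trans p q)

<ₒ-resp-≈ₒ : _<ₒ_ {ℓ} Respects₂ _≈ₒ_
<ₒ-resp-≈ₒ = (λ p q → <ₒ-≤ₒ-trans q (proj₁ p)) , (λ p q → ≤ₒ-<ₒ-trans (proj₂ p) q)

≤ₒ-isPreorder : IsPreorder (_≈ₒ_ {ℓ}) _≤ₒ_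
≤ₒ-isPreorder = record
  { isEquivalence = record
    { refl  = ≤ₒ-refl , ≤ₒ-refl
    ; sym   = swap
    ; trans = λ p q → ≤ₒ-trans (proj₁ p) (proj₁ q) , ≤ₒ-trans (proj₂ q) (proj₂ p)
    }
  ; reflexive = proj₁
  ; trans     = ≤ₒ-trans
  }

module ≤ₒ-Reasoning {ℓ : Level} where
  open import Relation.Binary.Reasoning.Base.Triple
    (≤ₒ-isPreorder {ℓ}) <ₒ-asym <ₒ-trans <ₒ-resp-≈ₒ <ₒ⇒≤ₒ <ₒ-≤ₒ-trans ≤ₒ-<ₒ-trans
    public

open ≤ₒ-Reasoning

𝟘≤ : 𝟘 ≤ₒ α
𝟘≤ (lift ())

<sucₒ : α <ₒ sucₒ α
<sucₒ = lift zero , ≤ₒ-refl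

-- Sums

+-<-inv : ∀ (α β : Ord ℓ) {ξ} → ξ <ₒ α +ₒ β → ξ <ₒ α ⊎ ∃[ δ ] δ <ₒ β × ξ ≤ₒ α +ₒ δ
+-<-inv (lsub _ _) (lsub _ _) (inj₁ i , p) = inj₁ (i , p)
+-<-inv (lsub _ _) (lsub _ g) (inj₂ j , p) = inj₂ (g j , (j , ≤ₒ-refl) , p)

+-least : α ≤ₒ γ → (∀ {δ} → δ <ₒ β → α +ₒ δ <ₒ γ) → α +ₒ β ≤ₒ γ
+-least {α = lsub _ _} {β = lsub _ _} p q (inj₁ i) = p i
+-least {α = lsub _ _} {β = lsub _ _} p q (inj₂ j) = q (j , ≤ₒ-refl)

+-monoʳ-≤ : β ≤ₒ β′ → α +ₒ β ≤ₒ α +ₒ β′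
+-monoʳ-≤ {β = lsub _ _} {β′ = lsub _ _} {α = lsub _ _} p (inj₁ i) = inj₁ i , ≤ₒ-refl
+-monoʳ-≤ {β = lsub _ _} {β′ = lsub _ _} {α = lsub _ _} p (inj₂ j) =
  inj₂ (proj₁ (p j)) , +-monoʳ-≤ (proj₂ (p j))

+-monoʳ-< : β <ₒ β′ → α +ₒ β <ₒ α +ₒ β′
+-monoʳ-< {β′ = lsub _ _} {α = lsub _ _} (j , p) = inj₂ j , +-monoʳ-≤ p

α≤α+β : α ≤ₒ α +ₒ β
α≤α+β {α = lsub _ _} {β = lsub _ _} i = inj₁ i , ≤ₒ-refl

β≤α+β : β ≤ₒ α +ₒ β
β≤α+β {β = lsub _ _} {α = lsub _ _} j = inj₂ j , β≤α+β

α<α+β : 𝟘 <ₒ β → α <ₒ α +ₒ β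
α<α+β p = ≤ₒ-<ₒ-trans α≤α+β (+-monoʳ-< p)

+-monoˡ-≤ : α ≤ₒ α′ → α +ₒ β ≤ₒ α′ +ₒ β
+-monoˡ-≤ {α = lsub _ _} {β = lsub _ _} p (inj₁ i) = <ₒ-≤ₒ-trans (p i) α≤α+β
+-monoˡ-≤ {α = lsub _ _} {α′ = lsub _ _} {β = lsub _ _} p (inj₂ j) = inj₂ j , +-monoˡ-≤ p

⊕-<-inv : ∀ (α β : Ord ℓ) {ξ} → ξ <ₒ α ⊕ β →
          (∃[ δ ] δ <ₒ α × ξ ≤ₒ δ ⊕ β) ⊎ (∃[ δ ] δ <ₒ β × ξ ≤ₒ α ⊕ δ)
⊕-<-inv (lsub _ f) (lsub _ _) (inj₁ i , p) = inj₁ (f i , (i , ≤ₒ-refl) , p)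
⊕-<-inv (lsub _ _) (lsub _ g) (inj₂ j , p) = inj₂ (g j , (j , ≤ₒ-refl) , p)

⊕-least : (∀ {δ} → δ <ₒ α → δ ⊕ β <ₒ γ) → (∀ {δ} → δ <ₒ β → α ⊕ δ <ₒ γ) → α ⊕ β ≤ₒ γ
⊕-least {α = lsub _ _} {β = lsub _ _} p q (inj₁ i) = p (i , ≤ₒ-refl)
⊕-least {α = lsub _ _} {β = lsub _ _} p q (inj₂ j) = q (j , ≤ₒ-refl)

⊕-mono-≤ : α ≤ₒ α′ → β ≤ₒ β′ → α ⊕ β ≤ₒ α′ ⊕ β′
⊕-mono-≤ {α = lsub _ _} {lsub _ _} {lsub _ _} {lsub _ _} p q (inj₁ i) =
  inj₁ (proj₁ (p i)) , ⊕-mono-≤ (proj₂ (p i)) q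
⊕-mono-≤ {α = lsub _ _} {lsub _ _} {lsub _ _} {lsub _ _} p q (inj₂ j) =
  inj₂ (proj₁ (q j)) , ⊕-mono-≤ p (proj₂ (q j))

⊕-monoˡ-≤ : α ≤ₒ α′ → α ⊕ β ≤ₒ α′ ⊕ β
⊕-monoˡ-≤ p = ⊕-mono-≤ p ≤ₒ-refl

⊕-monoʳ-≤ : β ≤ₒ β′ → α ⊕ β ≤ₒ α ⊕ β′
⊕-monoʳ-≤ = ⊕-mono-≤ ≤ₒ-refl

⊕-monoˡ-< : α <ₒ α′ → α ⊕ β <ₒ α′ ⊕ β
⊕-monoˡ-< {α′ = lsub _ _} {β = lsub _ _} (i , p) = inj₁ i , ⊕-monoˡ-≤ p

⊕-monoʳ-< : β <ₒ β′ → α ⊕ β <ₒ α ⊕ β′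
⊕-monoʳ-< {β′ = lsub _ _} {α = lsub _ _} (j , p) = inj₂ j , ⊕-monoʳ-≤ p

⊕-comm : ∀ (α β : Ord ℓ) → α ⊕ β ≤ₒ β ⊕ α
⊕-comm (lsub _ f) (lsub _ _) (inj₁ i) = inj₂ i , ⊕-comm (f i) _
⊕-comm (lsub _ _) (lsub _ g) (inj₂ j) = inj₁ j , ⊕-comm _ (g j)

⊕-assocʳ : ∀ (α β γ : Ord ℓ) → (α ⊕ β) ⊕ γ ≤ₒ α ⊕ (β ⊕ γ)
⊕-assocʳ (lsub _ f) (lsub _ _) (lsub _ _) (inj₁ (inj₁ i)) = inj₁ i , ⊕-assocʳ (f i) _ _
⊕-assocʳ (lsub _ _) (lsub _ g) (lsub _ _) (inj₁ (inj₂ j)) = inj₂ (inj₁ j) , ⊕-assocʳ _ (g j) _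
⊕-assocʳ (lsub _ _) (lsub _ _) (lsub _ h) (inj₂ k) = inj₂ (inj₂ k) , ⊕-assocʳ _ _ (h k)

⊕-assocˡ : ∀ (α β γ : Ord ℓ) → α ⊕ (β ⊕ γ) ≤ₒ (α ⊕ β) ⊕ γ
⊕-assocˡ (lsub _ f) (lsub _ _) (lsub _ _) (inj₁ i) = inj₁ (inj₁ i) , ⊕-assocˡ (f i) _ _
⊕-assocˡ (lsub _ _) (lsub _ g) (lsub _ _) (inj₂ (inj₁ j)) = inj₁ (inj₂ j) , ⊕-assocˡ _ (g j) _
⊕-assocˡ (lsub _ _) (lsub _ _) (lsub _ h) (inj₂ (inj₂ k)) = inj₂ k , ⊕-assocˡ _ _ (h k)

α≤α⊕β : α ≤ₒ α ⊕ β
α≤α⊕β {α = lsub _ _} {β = lsub _ _} i = inj₁ i , α≤α⊕β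

β≤α⊕β : β ≤ₒ α ⊕ β
β≤α⊕β {β = lsub _ _} {α = lsub _ _} j = inj₂ j , β≤α⊕β

⊕-identityʳ : α ⊕ 𝟘 ≤ₒ α
⊕-identityʳ {α = lsub _ _} (inj₁ i) = i , ⊕-identityʳ
⊕-identityʳ {α = lsub _ _} (inj₂ (lift ()))

·-mono-≤ : ∀ k → α ≤ₒ β → α ·ₒ k ≤ₒ β ·ₒ k
·-mono-≤ zero    p = ≤ₒ-refl
·-mono-≤ (suc k) p = ≤ₒ-trans (+-monoˡ-≤ (·-mono-≤ k p)) (+-monoʳ-≤ p)

ω^-mono-≤ : α ≤ₒ β → ω^ α ≤ₒ ω^ β
ω^-mono-≤ {α = lsub _ _} {β = lsub _ _} p nothing        = nothing , ≤ₒ-refl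
ω^-mono-≤ {α = lsub _ _} {β = lsub _ _} p (just (i , k)) =
  just (proj₁ (p i) , k) , ·-mono-≤ k (ω^-mono-≤ (proj₂ (p i)))

𝟘<ω^ : 𝟘 <ₒ ω^ α
𝟘<ω^ {α = lsub _ _} = nothing , ≤ₒ-refl

ω^<ω^ : α <ₒ β → ω^ α <ₒ ω^ β
ω^<ω^ {β = lsub _ _} (i , p) = just (i , 1) , ≤ₒ-trans (ω^-mono-≤ p) β≤α+β

α≤ω^α : α ≤ₒ ω^ α
α≤ω^α {α = lsub _ f} i = ≤ₒ-<ₒ-trans α≤ω^α (ω^<ω^ {α = f i} (i , ≤ₒ-refl))

+≤⊕ : α +ₒ β ≤ₒ α ⊕ β
+≤⊕ {α = lsub _ _} {β = lsub _ _} (inj₁ i) = inj₁ i , α≤α⊕β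
+≤⊕ {α = lsub _ _} {β = lsub _ _} (inj₂ j) = inj₂ j , +≤⊕

-- Ordinals closed under natural sums

Closed : Ord ℓ → Set _
Closed w = ∀ {ξ δ} → ξ <ₒ w → δ <ₒ w → ξ ⊕ δ <ₒ w

Closed⇒+ : Closed w → α <ₒ w → β <ₒ w → α +ₒ β <ₒ w
Closed⇒+ c p q = ≤ₒ-<ₒ-trans +≤⊕ (c p q)

-- The natural sum of the listed values serves as a common bound: it dominates every summand, and
-- closure keeps it below `w`.
Closed-bound : ∀ {a} {A : Set a} → Closed w → 𝟘 <ₒ w → (g : A → Ord ℓ) → (∀ x → g x <ₒ w) →
               (xs : List A) → ∃[ μ ] μ <ₒ w × All (λ x → g x ≤ₒ μ) xs
Closed-bound c 𝟘<w g g< []       = 𝟘 , 𝟘<w , []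
Closed-bound c 𝟘<w g g< (x ∷ xs) =
  let (μ , μ<w , ps) = Closed-bound c 𝟘<w g g< xs
  in g x ⊕ μ , c (g< x) μ<w , α≤α⊕β ∷ All.map (λ p → ≤ₒ-trans p β≤α⊕β) ps

-- The head of the list is the last summand.
revSum : List (Ord ℓ) → Ord ℓ
revSum []       = 𝟘
revSum (w ∷ ws) = revSum ws +ₒ w

-- Natural against ordinary sums of closed ordinals

module _ (em : EM) where

  ≮⇒≥ : ∀ {α β : Ord ℓ} → ¬ α <ₒ β → β ≤ₒ α
  ≮⇒≥ {α = α} {β} p with ≤ₒ-or->ₒ em β α
  ... | inj₁ q = q
  ... | inj₂ q = ⊥-elim (p q)

  +-cancelˡ-≤ : ∀ (α : Ord ℓ) {β γ} → α +ₒ β ≤ₒ α +ₒ γ → β ≤ₒ γ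
  +-cancelˡ-≤ α {β} {γ} p = ≮⇒≥ λ q → <ₒ-irrefl {α = α +ₒ β} (begin-strict
    α +ₒ β ≤⟨ p ⟩
    α +ₒ γ <⟨ +-monoʳ-< q ⟩
    α +ₒ β ∎)

  -- The remainder is the least ρ with ξ ≤ α + ρ.
  +-subtract : ∀ {α ξ : Ord ℓ} → α ≤ₒ ξ → ∃[ ρ ] ξ ≈ₒ α +ₒ ρ
  +-subtract {α = α} {ξ} α≤ξ = go ξ β≤α+β
    where
    go : ∀ ρ → ξ ≤ₒ α +ₒ ρ → ∃[ ρ ] ξ ≈ₒ α +ₒ ρ
    go ρ@(lsub J g) p with em {P = ∃[ j ] ξ ≤ₒ α +ₒ g j}
    ... | yes (j , q) = go (g j) q
    ... | no ¬q = ρ , p , +-least α≤ξ λ {δ} → below δ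
      where
      below : ∀ δ → δ <ₒ ρ → α +ₒ δ <ₒ ξ
      below δ (j , δ≤) with ≤ₒ-or->ₒ em ξ (α +ₒ g j)
      ... | inj₁ q = ⊥-elim (¬q (j , q))
      ... | inj₂ q = ≤ₒ-<ₒ-trans (+-monoʳ-≤ δ≤) q

  mutual
    -- If `ξ` reaches into the last summand `u`, its remainder there together with `δ` stays below
    -- `u` by closure. Otherwise recursion on the list applies.
    revSum-absorbs : ∀ {ws : List (Ord ℓ)} {w δ ξ} → All Closed ws → AllPairs _≤ₒ_ ws →
                     All (w ≤ₒ_) ws → δ <ₒ w → ξ <ₒ revSum ws → ξ ⊕ δ <ₒ revSum ws
    revSum-absorbs {ws = u ∷ us} {δ = δ} {ξ} (cu ∷ cus) (u≤ ∷ s) (w≤u ∷ w≤) δ<w ξ<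
      with +-<-inv (revSum us) u ξ<
    ... | inj₁ p = <ₒ-≤ₒ-trans (revSum-absorbs cus s w≤ δ<w p) α≤α+β
    ... | inj₂ (ρ , ρ<u , p) = begin-strict
      ξ ⊕ δ                ≤⟨ ⊕-monoˡ-≤ p ⟩
      (revSum us +ₒ ρ) ⊕ δ ≤⟨ ⊕-monoˡ-≤ +≤⊕ ⟩
      revSum us ⊕ ρ ⊕ δ    ≤⟨ ⊕-assocʳ (revSum us) ρ δ ⟩
      revSum us ⊕ (ρ ⊕ δ)  ≤⟨ revSum-⊕-< cus s u≤ ρ⊕δ<u ⟩
      revSum us +ₒ (ρ ⊕ δ) <⟨ +-monoʳ-< ρ⊕δ<u ⟩
      revSum us +ₒ u       ∎
      where ρ⊕δ<u = cu ρ<u (<ₒ-≤ₒ-trans δ<w w≤u)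

    -- Lowering the left argument leads, by absorption, below `revSum ws`; lowering `δ` is covered
    -- by recursion on its code.
    revSum-⊕-< : ∀ {ws : List (Ord ℓ)} {w δ} → All Closed ws → AllPairs _≤ₒ_ ws →
                 All (w ≤ₒ_) ws → δ <ₒ w → revSum ws ⊕ δ ≤ₒ revSum ws +ₒ δ
    revSum-⊕-< {ws = ws} {δ = δ@(lsub _ g)} cs s w≤ δ<w = ⊕-least
      (λ ξ< → <ₒ-≤ₒ-trans (revSum-absorbs cs s w≤ δ<w ξ<) α≤α+β)
      λ { {γ} (j , p) → begin-strict
            revSum ws ⊕ γ    ≤⟨ ⊕-monoʳ-≤ p ⟩
            revSum ws ⊕ g j  ≤⟨ revSum-⊕-< cs s w≤ (<ₒ-trans (j , ≤ₒ-refl) δ<w) ⟩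
            revSum ws +ₒ g j <⟨ +-monoʳ-< (j , ≤ₒ-refl) ⟩
            revSum ws +ₒ δ   ∎ }

  revSum-⊕ : ∀ {ws : List (Ord ℓ)} {w} → All Closed ws → AllPairs _≤ₒ_ ws →
             All (w ≤ₒ_) ws → revSum ws ⊕ w ≤ₒ revSum ws +ₒ w
  revSum-⊕ {ws = ws} {w} cs s w≤ = ⊕-least (left ws cs s w≤)
    (λ δ<w → ≤ₒ-<ₒ-trans (revSum-⊕-< cs s w≤ δ<w) (+-monoʳ-< δ<w))
    where
    left : ∀ ws → All Closed ws → AllPairs _≤ₒ_ ws → All (w ≤ₒ_) ws →
           ∀ {ξ} → ξ <ₒ revSum ws → ξ ⊕ w <ₒ revSum ws +ₒ w
    left (u ∷ us) cs@(cu ∷ cus) s@(u≤ ∷ s′) w≤@(w≤u ∷ w≤us) {ξ} ξ< with +-<-inv (revSum us) u ξ<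
    ... | inj₁ p = begin-strict
      ξ ⊕ w                <⟨ ⊕-monoˡ-< p ⟩
      revSum us ⊕ w        ≤⟨ revSum-⊕ cus s′ w≤us ⟩
      revSum us +ₒ w       ≤⟨ +-monoˡ-≤ α≤α+β ⟩
      revSum us +ₒ u +ₒ w  ∎
    ... | inj₂ (ρ , ρ<u , p) with ≤ₒ-or->ₒ em u w
    -- Closure absorbs `ρ ⊕ w` into the summand `u`.
    ...   | inj₂ w<u = begin-strict
      ξ ⊕ w                ≤⟨ ⊕-monoˡ-≤ p ⟩
      (revSum us +ₒ ρ) ⊕ w ≤⟨ ⊕-monoˡ-≤ +≤⊕ ⟩
      revSum us ⊕ ρ ⊕ w    ≤⟨ ⊕-assocʳ (revSum us) ρ w ⟩
      revSum us ⊕ (ρ ⊕ w)  ≤⟨ revSum-⊕-< cus s′ u≤ (cu ρ<u w<u) ⟩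
      revSum us +ₒ (ρ ⊕ w) <⟨ +-monoʳ-< (cu ρ<u w<u) ⟩
      revSum us +ₒ u       ≤⟨ α≤α+β ⟩
      revSum us +ₒ u +ₒ w  ∎
    -- Now `u` and `w` are equivalent, so `w` can take the place of `u`, while `ρ` becomes a tail
    -- below the final summand `w`.
    ...   | inj₁ u≤w = begin-strict
      ξ ⊕ w                ≤⟨ ⊕-monoˡ-≤ p ⟩
      (revSum us +ₒ ρ) ⊕ w ≤⟨ ⊕-monoˡ-≤ +≤⊕ ⟩
      revSum us ⊕ ρ ⊕ w    ≤⟨ ⊕-assocʳ (revSum us) ρ w ⟩
      revSum us ⊕ (ρ ⊕ w)  ≤⟨ ⊕-monoʳ-≤ (⊕-comm ρ w) ⟩
      revSum us ⊕ (w ⊕ ρ)  ≤⟨ ⊕-assocˡ (revSum us) w ρ ⟩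
      revSum us ⊕ w ⊕ ρ    ≤⟨ ⊕-monoˡ-≤ (revSum-⊕ cus s′ w≤us) ⟩
      (revSum us +ₒ w) ⊕ ρ ≤⟨ ⊕-monoˡ-≤ (+-monoʳ-≤ w≤u) ⟩
      (revSum us +ₒ u) ⊕ ρ ≤⟨ revSum-⊕-< cs s w≤ ρ<w ⟩
      revSum us +ₒ u +ₒ ρ  <⟨ +-monoʳ-< ρ<w ⟩
      revSum us +ₒ u +ₒ w  ∎
      where ρ<w = <ₒ-≤ₒ-trans ρ<u u≤w

  -- By sortedness the head is at most every summand preceding it in the ordinary sum, so adding it
  -- naturally gives no more than appending it.
  ⨁≤revSum : ∀ {ws : List (Ord ℓ)} → All Closed ws → AllPairs _≤ₒ_ ws → ⨁ ws ≤ₒ revSum ws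
  ⨁≤revSum []       []       = ≤ₒ-refl
  ⨁≤revSum {ws = w ∷ ws} (c ∷ cs) (w≤ ∷ s) = begin
    w ⊕ ⨁ ws       ≤⟨ ⊕-monoʳ-≤ (⨁≤revSum cs s) ⟩
    w ⊕ revSum ws  ≤⟨ ⊕-comm w (revSum ws) ⟩
    revSum ws ⊕ w  ≤⟨ revSum-⊕ cs s w≤ ⟩
    revSum ws +ₒ w ∎

  ·-⊕ : ∀ {w : Ord ℓ} → Closed w → ∀ k → w ·ₒ k ⊕ w ≤ₒ w ·ₒ suc k
  ·-⊕ {w = w} c k = subst (λ σ → σ ⊕ w ≤ₒ σ +ₒ w) (revSum-replicate k)
    (revSum-⊕ (All.replicate⁺ k c) (sorted k) (All.replicate⁺ k ≤ₒ-refl))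
    where
    sorted : ∀ k → AllPairs _≤ₒ_ (replicate k w)
    sorted zero    = []
    sorted (suc k) = All.replicate⁺ k ≤ₒ-refl ∷ sorted k

    revSum-replicate : ∀ k → revSum (replicate k w) ≡ w ·ₒ k
    revSum-replicate zero    = refl
    revSum-replicate (suc k) = cong (_+ₒ w) (revSum-replicate k)

  ·-⊕-· : ∀ {w : Ord ℓ} → Closed w → ∀ k j → w ·ₒ k ⊕ w ·ₒ j ≤ₒ w ·ₒ (j ℕ.+ k)
  ·-⊕-· c k zero = ⊕-identityʳ
  ·-⊕-· {w = w} c k (suc j) = begin
    w ·ₒ k ⊕ w ·ₒ suc j    ≤⟨ ⊕-monoʳ-≤ +≤⊕ ⟩
    w ·ₒ k ⊕ (w ·ₒ j ⊕ w)  ≤⟨ ⊕-assocˡ (w ·ₒ k) (w ·ₒ j) w ⟩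
    w ·ₒ k ⊕ w ·ₒ j ⊕ w    ≤⟨ ⊕-monoˡ-≤ (·-⊕-· c k j) ⟩
    w ·ₒ (j ℕ.+ k) ⊕ w     ≤⟨ ·-⊕ c (j ℕ.+ k) ⟩
    w ·ₒ suc (j ℕ.+ k)     ∎

  -- Ordinals below `ω^ e` are bounded by finite multiples of smaller powers. Passing to the larger
  -- of two such powers, which is closed by induction, leaves a sum of multiples of one power.
  ω^-Closed : ∀ (e : Ord ℓ) → Closed (ω^ e)
  ω^-Closed (lsub I f) {ξ} {δ} (nothing , p) (i , q) = i , (begin
    ξ ⊕ δ  ≤⟨ ⊕-mono-≤ p ≤ₒ-refl ⟩
    𝟘 ⊕ δ  ≤⟨ ⊕-comm 𝟘 δ ⟩
    δ ⊕ 𝟘  ≤⟨ ⊕-identityʳ ⟩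
    δ      ≤⟨ q ⟩
    _      ∎)
  ω^-Closed (lsub I f) {ξ} {δ} (i@(just _) , p) (nothing , q) = i , (begin
    ξ ⊕ δ  ≤⟨ ⊕-mono-≤ p q ⟩
    _ ⊕ 𝟘  ≤⟨ ⊕-identityʳ ⟩
    _      ∎)
  ω^-Closed (lsub I f) {ξ} {δ} (just (i , k) , p) (just (j , m) , q)
    with ≤ₒ-or->ₒ em (ω^ f i) (ω^ f j)
  ... | inj₁ i≤j = just (j , m ℕ.+ k) , (begin
    ξ ⊕ δ                        ≤⟨ ⊕-mono-≤ p q ⟩
    (ω^ f i) ·ₒ k ⊕ (ω^ f j) ·ₒ m  ≤⟨ ⊕-monoˡ-≤ (·-mono-≤ k i≤j) ⟩
    (ω^ f j) ·ₒ k ⊕ (ω^ f j) ·ₒ m  ≤⟨ ·-⊕-· (ω^-Closed (f j)) k m ⟩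
    (ω^ f j) ·ₒ (m ℕ.+ k)          ∎)
  ... | inj₂ j<i = just (i , m ℕ.+ k) , (begin
    ξ ⊕ δ                        ≤⟨ ⊕-mono-≤ p q ⟩
    (ω^ f i) ·ₒ k ⊕ (ω^ f j) ·ₒ m  ≤⟨ ⊕-monoʳ-≤ (·-mono-≤ m (<ₒ⇒≤ₒ j<i)) ⟩
    (ω^ f i) ·ₒ k ⊕ (ω^ f i) ·ₒ m  ≤⟨ ·-⊕-· (ω^-Closed (f i)) k m ⟩
    (ω^ f i) ·ₒ (m ℕ.+ k)          ∎)

  -- Descent through the code of `e`: a bound `(ω^ f i) ·ₒ k` is kept if `ω^ f i` is at most `γ`;
  -- otherwise `γ` lies below that smaller power.
  leading-power : ∀ (e : Ord ℓ) {γ} → γ <ₒ ω^ e →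
                  γ ≤ₒ 𝟘 ⊎ ∃₂ λ e′ k → ω^ e′ ≤ₒ γ × γ ≤ₒ (ω^ e′) ·ₒ k
  leading-power (lsub I f) (nothing , p) = inj₁ p
  leading-power (lsub I f) {γ} (just (i , k) , p) with ≤ₒ-or->ₒ em (ω^ f i) γ
  ... | inj₁ q = inj₂ (f i , k , q , p)
  ... | inj₂ q = leading-power (f i) q

  -- w exceeds all finite multiples of the leading power of ω of any ordinal below it.
  indecomposable⇒Closed : ∀ {w : Ord ℓ} → (∀ {γ} → γ <ₒ w → γ +ₒ w ≤ₒ w) → Closed w
  indecomposable⇒Closed {w = w} indec {ξ} {δ} ξ<w δ<w =
    [ (λ ξ≤δ → ≤ₒ-<ₒ-trans (⊕-monoˡ-≤ ξ≤δ) (double δ<w))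
    , (λ δ<ξ → ≤ₒ-<ₒ-trans (⊕-monoʳ-≤ (<ₒ⇒≤ₒ δ<ξ)) (double ξ<w))
    ]′ (≤ₒ-or->ₒ em ξ δ)
    where
    multiple : ∀ {v} → v <ₒ w → ∀ k → v ·ₒ k <ₒ w
    multiple v<w zero    = ≤ₒ-<ₒ-trans 𝟘≤ v<w
    multiple v<w (suc k) = <ₒ-≤ₒ-trans (+-monoʳ-< v<w) (indec (multiple v<w k))

    double : ∀ {μ} → μ <ₒ w → μ ⊕ μ <ₒ w
    -- The exponent `sucₒ μ` is large enough: `μ` is at most `ω^ μ`, hence below the next power.
    double {μ} μ<w with leading-power (sucₒ μ) (≤ₒ-<ₒ-trans α≤ω^α (ω^<ω^ <sucₒ))
    ... | inj₁ μ≤𝟘 = begin-strict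
      μ ⊕ μ ≤⟨ ⊕-monoʳ-≤ μ≤𝟘 ⟩
      μ ⊕ 𝟘 ≤⟨ ⊕-identityʳ ⟩
      μ     <⟨ μ<w ⟩
      w     ∎
    ... | inj₂ (e , k , v≤μ , μ≤vk) = begin-strict
      μ ⊕ μ                       ≤⟨ ⊕-mono-≤ μ≤vk μ≤vk ⟩
      (ω^ e) ·ₒ k ⊕ (ω^ e) ·ₒ k   ≤⟨ ·-⊕-· (ω^-Closed e) k k ⟩
      (ω^ e) ·ₒ (k ℕ.+ k)         <⟨ multiple (≤ₒ-<ₒ-trans v≤μ μ<w) (k ℕ.+ k) ⟩
      w                           ∎

-- Ranks of antichains

AllPairs-reverse : ∀ {A : Set a} {R : Rel A r} → Symmetric R →
                   ∀ {xs} → AllPairs R xs → AllPairs R (reverse xs)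
AllPairs-reverse R-sym []                        = []
AllPairs-reverse {R = R} R-sym {x ∷ xs} (px ∷ p) =
  subst (AllPairs R) (sym (unfold-reverse x xs))
    (AllPairs.++⁺ (AllPairs-reverse R-sym p) ([] ∷ [])
                  (All.tabulate (λ y∈ → R-sym (All.lookup px (Any.reverse⁻ y∈)) ∷ [])))

reverse-≢[] : ∀ {A : Set a} (x : A) xs → reverse (x ∷ xs) ≢ []
reverse-≢[] x xs eq with reverse xs | trans (sym (unfold-reverse x xs)) eq
... | []    | ()
... | _ ∷ _ | ()

module _ (em : EM) (A : WQO c ℓ₁ ℓ₂) where
  open WQO A using (Carrier)

  private
    _⊥_ : Rel Carrier ℓ₂
    _⊥_ = Incomparable A

    inc : ∀ x xs → AllPairs _⊥_ (x ∷ xs) → Inc A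
    inc x xs p = reverse (x ∷ xs) , reverse-≢[] x xs , AllPairs-reverse swap p

    -- `rank` recurses on accessibility proofs, and elements of `Inc` carry proofs too. Only the
    -- underlying list matters, since equal lists have the same proper extensions.
    rank-cong : ∀ {s t} (p : Acc (_⊐_ A) s) (q : Acc (_⊐_ A) t) → proj₁ s ≡ proj₁ t →
                rank A p ≤ₒ rank A q
    rank-cong (acc rs) (acc ts) refl (u , u⊐s) = (u , u⊐s) , rank-cong (rs u⊐s) (ts u⊐s) refl

    rank-⊐ : ∀ {s t} (p : Acc (_⊐_ A) s) (q : Acc (_⊐_ A) t) → _⊐_ A t s → rank A q <ₒ rank A p
    rank-⊐ {t = t} (acc rs) q t⊐s = (t , t⊐s) , rank-cong q (rs t⊐s) refl

    rank-least : ∀ {s γ} (p : Acc (_⊐_ A) s) →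
                 (∀ t (q : Acc (_⊐_ A) t) → _⊐_ A t s → rank A q <ₒ γ) → rank A p ≤ₒ γ
    rank-least (acc rs) h (t , t⊐s) = h t (rs t⊐s) t⊐s

    wf : ∀ s → Acc (_⊐_ A) s
    wf = ⊐-wellFounded A em

  -- The rank of an antichain listed with its latest element first, and the width
  -- of A for the empty antichain.
  rk : ∀ xs → AllPairs _⊥_ xs → Ord (c ⊔ ℓ₂)
  rk []       p = width A em
  rk (x ∷ xs) p = rank A (wf (inc x xs p))

  rk-∷ : ∀ {x} xs p (x⊥ : All (x ⊥_) xs) → rk (x ∷ xs) (x⊥ ∷ p) <ₒ rk xs p
  rk-∷ {x} []       [] x⊥ = inc x [] (x⊥ ∷ []) , ≤ₒ-refl
  rk-∷ {x} (y ∷ ys) p  x⊥ = rank-⊐ (wf (inc y ys p)) (wf (inc x (y ∷ ys) (x⊥ ∷ p)))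
    (x , [] , unfold-reverse x (y ∷ ys))

  private
    -- Every proper extension passes through a one-element extension, whose rank is at least as
    -- large.
    extension : ∀ {γ} xs p → (∀ x x⊥ → rk (x ∷ xs) (x⊥ ∷ p) <ₒ γ) →
                ∀ t (q : Acc (_⊐_ A) t) x zs → proj₁ t ≡ reverse xs ++ x ∷ zs → rank A q <ₒ γ
    extension xs p h (_ , _ , t-anti) q x zs refl = ≤ₒ-<ₒ-trans (bound zs q refl) (h x x⊥)
      where
      x⊥ : All (x ⊥_) xs
      x⊥ = All.tabulate λ y∈ → swap (AllPairs-++ A (reverse xs) t-anti (Any.reverse⁺ y∈))

      bound : ∀ zs {t} (q : Acc (_⊐_ A) t) → proj₁ t ≡ reverse xs ++ x ∷ zs →
              rank A q ≤ₒ rk (x ∷ xs) (x⊥ ∷ p)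
      bound []       q eq = rank-cong q (wf (inc x xs (x⊥ ∷ p))) (trans eq (sym (unfold-reverse x xs)))
      bound (z ∷ zs) q eq = <ₒ⇒≤ₒ (rank-⊐ (wf (inc x xs (x⊥ ∷ p))) q
        (z , zs , trans eq (trans (sym (++-assoc (reverse xs) [ x ] (z ∷ zs)))
                                  (cong (_++ z ∷ zs) (sym (unfold-reverse x xs))))))

  -- With `rk-∷` this determines `rk` by single moves, as the least strict upper bound of the ranks
  -- after one more element.
  rk-least : ∀ {γ} xs p → (∀ x x⊥ → rk (x ∷ xs) (x⊥ ∷ p) <ₒ γ) → rk xs p ≤ₒ γ
  rk-least []       [] h ([] , ≢[] , _)     = ⊥-elim (≢[] refl)
  rk-least []       [] h t@(x ∷ zs , _)     = extension [] [] h t (wf t) x zs refl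
  rk-least (y ∷ ys) p  h = rank-least (wf (inc y ys p)) λ where
    t q (x , zs , eq) → extension (y ∷ ys) p h t q x zs eq

  rk-<-inv : ∀ {γ} xs p → γ <ₒ rk xs p → ∃₂ λ x x⊥ → γ ≤ₒ rk (x ∷ xs) (x⊥ ∷ p)
  rk-<-inv {γ} xs p γ<rk with em {P = ∃₂ λ x x⊥ → γ ≤ₒ rk (x ∷ xs) (x⊥ ∷ p)}
  ... | yes r = r
  ... | no ¬r = ⊥-elim (<ₒ-irrefl (<ₒ-≤ₒ-trans γ<rk (rk-least xs p below)))
    where
    below : ∀ x x⊥ → rk (x ∷ xs) (x⊥ ∷ p) <ₒ γ
    below x x⊥ with ≤ₒ-or->ₒ em γ (rk (x ∷ xs) (x⊥ ∷ p))
    ... | inj₁ γ≤ = ⊥-elim (¬r (x , x⊥ , γ≤))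
    ... | inj₂ <γ = <γ

-- Comparing widths along maps

module _ (em : EM) (A : WQO c ℓ₁ ℓ₂) (B : WQO c ℓ₁ ℓ₂) where
  private
    module A = WQO A
    module B = WQO B
    _⊥ᴬ_ = Incomparable A
    _⊥ᴮ_ = Incomparable B

  -- `F` and `G` are the antichains already played in `A` and `B`.
  module _ (θ : A.Carrier → B.Carrier) (θ-⊥ : ∀ {x y} → x ⊥ᴬ y → θ x ⊥ᴮ θ y)
           {F G} (θ-G : ∀ {y} → All (y ⊥ᴬ_) F → All (θ y ⊥ᴮ_) G) where

    -- The antichain played in B consists of G followed by θ-images; σ more moves remain afterwards.
    sum-simulation : ∀ {σ} → (∀ u q → σ ≤ₒ rk em B (map θ u ++ G) q) →
                     ∀ p q → σ +ₒ rk em A F p ≤ₒ rk em B G q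
    sum-simulation {σ} base p q = go [] p q (<ₒ-wellFounded _)
      where
      go : ∀ u p q → Acc _<ₒ_ (rk em A (u ++ F) p) →
           σ +ₒ rk em A (u ++ F) p ≤ₒ rk em B (map θ u ++ G) q
      go u p q (acc rs) = +-least (base u q) step
        where
        step : ∀ {δ} → δ <ₒ rk em A (u ++ F) p → σ +ₒ δ <ₒ rk em B (map θ u ++ G) q
        step {δ} δ< with rk-<-inv em A (u ++ F) p δ<
        ... | y , y⊥ , δ≤ = begin-strict
          σ +ₒ δ                                  ≤⟨ +-monoʳ-≤ δ≤ ⟩
          σ +ₒ rk em A (y ∷ u ++ F) (y⊥ ∷ p)
            ≤⟨ go (y ∷ u) (y⊥ ∷ p) (θy⊥ ∷ q) (rs (rk-∷ em A (u ++ F) p y⊥)) ⟩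
          rk em B (θ y ∷ map θ u ++ G) (θy⊥ ∷ q)  <⟨ rk-∷ em B (map θ u ++ G) q θy⊥ ⟩
          rk em B (map θ u ++ G) q                ∎
          where
          θy⊥ : All (θ y ⊥ᴮ_) (map θ u ++ G)
          θy⊥ = All.++⁺ (All.map⁺ (All.map θ-⊥ (All.++⁻ˡ u y⊥))) (θ-G (All.++⁻ʳ u y⊥))

    simulation : ∀ p q → rk em A F p ≤ₒ rk em B G q
    simulation p q = ≤ₒ-trans β≤α+β (sum-simulation (λ _ _ → 𝟘≤) p q)

-- Elements of `Any (Carrier ∘ B) L` are those of the disjoint sum of the B s for s in L.
module _ (em : EM) {S : Set} (B : S → WQO c ℓ₁ ℓ₂) where
  private
    P : S → Set c
    P s = WQO.Carrier (B s)

  -- Incomparability in the disjoint sum indexed by the positions of `L`.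
  _#_ : ∀ {L} → Rel (Any P L) ℓ₂
  here {s} x # here y  = Incomparable (B s) x y
  here _     # there _ = Lift _ ⊤
  there _    # here _  = Lift _ ⊤
  there d    # there e = d # e

  private
    heads : ∀ {s L} → List (Any P (s ∷ L)) → List (P s)
    heads []             = []
    heads (here x ∷ es)  = x ∷ heads es
    heads (there _ ∷ es) = heads es

    tails : ∀ {s L} → List (Any P (s ∷ L)) → List (Any P L)
    tails []             = []
    tails (here _ ∷ es)  = tails es
    tails (there e ∷ es) = e ∷ tails es

    All-heads : ∀ {s L} {x : P s} es → All (here {xs = L} x #_) es → All (Incomparable (B s) x) (heads es)
    All-heads []             []       = []
    All-heads (here _ ∷ es)  (p ∷ ps) = p ∷ All-heads es ps
    All-heads (there _ ∷ es) (_ ∷ ps) = All-heads es ps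

    All-tails : ∀ {s L} {e : Any P L} es → All (there {x = s} e #_) es → All (e #_) (tails es)
    All-tails []             []       = []
    All-tails (here _ ∷ es)  (_ ∷ ps) = All-tails es ps
    All-tails (there _ ∷ es) (p ∷ ps) = p ∷ All-tails es ps

    AllPairs-heads : ∀ {s L} {es : List (Any P (s ∷ L))} →
                     AllPairs _#_ es → AllPairs (Incomparable (B s)) (heads es)
    AllPairs-heads []                         = []
    AllPairs-heads {es = here _ ∷ es} (p ∷ ps)  = All-heads es p ∷ AllPairs-heads ps
    AllPairs-heads {es = there _ ∷ es} (_ ∷ ps) = AllPairs-heads ps

    AllPairs-tails : ∀ {s L} {es : List (Any P (s ∷ L))} → AllPairs _#_ es → AllPairs _#_ (tails es)
    AllPairs-tails []                         = []
    AllPairs-tails {es = here _ ∷ es} (_ ∷ ps)  = AllPairs-tails ps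
    AllPairs-tails {es = there _ ∷ es} (p ∷ ps) = All-tails es p ∷ AllPairs-tails ps

    -- A potential for antichains of the disjoint sum: a move in one component lowers that summand,
    -- hence the natural sum.
    totalRk : ∀ {L} (es : List (Any P L)) → AllPairs _#_ es → Ord (c ⊔ ℓ₂)
    totalRk {[]}    es ps = 𝟘
    totalRk {s ∷ L} es ps =
      rk em (B s) (heads es) (AllPairs-heads ps) ⊕ totalRk (tails es) (AllPairs-tails ps)

    totalRk-∷ : ∀ {L} {e} (es : List (Any P L)) ps (p : All (e #_) es) →
                totalRk (e ∷ es) (p ∷ ps) <ₒ totalRk es ps
    totalRk-∷ {s ∷ L} {here x}  es ps p =
      ⊕-monoˡ-< (rk-∷ em (B s) (heads es) (AllPairs-heads ps) (All-heads es p))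
    totalRk-∷ {s ∷ L} {there e} es ps p =
      ⊕-monoʳ-< (totalRk-∷ (tails es) (AllPairs-tails ps) (All-tails es p))

    totalRk-[] : ∀ L → totalRk {L} [] [] ≡ ⨁ (map (λ s → width (B s) em) L)
    totalRk-[] []      = refl
    totalRk-[] (s ∷ L) = cong (width (B s) em ⊕_) (totalRk-[] L)

  -- Each move in `A` strictly lowers `totalRk` of the image under `g`, so this potential bounds the
  -- remaining rank in `A`.
  width-≤-⨁ : (A : WQO c ℓ₁ ℓ₂) → ∀ {L} (g : WQO.Carrier A → Any P L) →
              (∀ {x y} → Incomparable A x y → g x # g y) →
              width A em ≤ₒ ⨁ (map (λ s → width (B s) em) L)
  width-≤-⨁ A {L} g g-# =
    subst (width A em ≤ₒ_) (totalRk-[] L) (go [] [] (<ₒ-wellFounded _))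
    where
    image : ∀ {xs} → AllPairs (Incomparable A) xs → AllPairs _#_ (map g xs)
    image p = AllPairs.map⁺ (AllPairs.map g-# p)

    go : ∀ xs p → Acc _<ₒ_ (rk em A xs p) → rk em A xs p ≤ₒ totalRk (map g xs) (image p)
    go xs p (acc rs) = rk-least em A xs p λ x x⊥ →
      ≤ₒ-<ₒ-trans (go (x ∷ xs) (x⊥ ∷ p) (rs (rk-∷ em A xs p x⊥)))
                  (totalRk-∷ (map g xs) (image p) (All.map⁺ (All.map g-# x⊥)))

  -- Two predicates occur because the two points are searched for separately in `L`; only searches
  -- ending at the same position leave something to prove.
  Any-map-# : ∀ {p} {Q R : S → Set p} {L} (f : ∀ {s} → Q s → P s) (g : ∀ {s} → R s → P s) →
              (∀ {s} (u : Q s) (v : R s) → Incomparable (B s) (f u) (g v)) →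
              (d : Any Q L) (e : Any R L) → Any.map f d # Any.map g e
  Any-map-# f g h (here u)  (here v)  = h u v
  Any-map-# f g h (here _)  (there _) = _
  Any-map-# f g h (there _) (here _)  = _
  Any-map-# f g h (there d) (there e) = Any-map-# f g h d e

-- Finite sums

-- The ordinal f 0 + … + f (j - 1) + ρ.
place : (f : Fin l → Ord ℓ) → Fin l → Ord ℓ → Ord ℓ
place f zero    ρ = ρ
place f (suc j) ρ = f zero +ₒ place (f ∘ suc) j ρ

place-monoʳ-≤ : ∀ (f : Fin l → Ord ℓ) j {ρ σ} → ρ ≤ₒ σ → place f j ρ ≤ₒ place f j σ
place-monoʳ-≤ f zero    p = p
place-monoʳ-≤ f (suc j) p = +-monoʳ-≤ (place-monoʳ-≤ (f ∘ suc) j p)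

ρ≤place : ∀ (f : Fin l → Ord ℓ) j {ρ} → ρ ≤ₒ place f j ρ
ρ≤place f zero    = ≤ₒ-refl
ρ≤place f (suc j) = ≤ₒ-trans (ρ≤place (f ∘ suc) j) β≤α+β

place<∑ : ∀ (f : Fin l → Ord ℓ) j {ρ} → ρ <ₒ f j → place f j ρ <ₒ ∑ f
place<∑ f zero    p = <ₒ-≤ₒ-trans p α≤α+β
place<∑ f (suc j) p = +-monoʳ-< (place<∑ (f ∘ suc) j p)

place-<-place : ∀ (f : Fin l → Ord ℓ) {j k ρ} σ → j Fin.< k → ρ <ₒ f j → place f j ρ <ₒ place f k σ
place-<-place f {zero}  {suc k} σ j<k       p = <ₒ-≤ₒ-trans p α≤α+β
place-<-place f {suc j} {suc k} σ (s≤s j<k) p = +-monoʳ-< (place-<-place (f ∘ suc) σ j<k p)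

place-first : ∀ (f : Fin l → Ord ℓ) j {ρ} → toℕ j ≡ 0 → place f j ρ ≡ ρ
place-first f zero _ = refl

-- Serves to show that a Cantor normal form with all exponents zero denotes a finite ordinal.
∑-≤-fromℕ : ∀ (f : Fin l → Ord ℓ) → (∀ j → f j ≤ₒ sucₒ 𝟘) → ∑ f ≤ₒ fromℕ l
∑-≤-fromℕ {l = zero}  f f≤ = ≤ₒ-refl
∑-≤-fromℕ {l = suc l} {ℓ} f f≤ =
  ≤ₒ-trans (+-monoˡ-≤ (f≤ zero)) (≤ₒ-trans (+-monoʳ-≤ (∑-≤-fromℕ (f ∘ suc) (f≤ ∘ suc))) (1+ l))
  where
  1+ : ∀ m → sucₒ 𝟘 +ₒ fromℕ {ℓ} m ≤ₒ sucₒ (fromℕ m)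
  1+ zero    (inj₁ _)         = lift zero , 𝟘≤
  1+ zero    (inj₂ (lift ()))
  1+ (suc m) (inj₁ _)         = lift zero , 𝟘≤
  1+ (suc m) (inj₂ (lift _))  = lift zero , 1+ m

ω^-≤-1 : ∀ {e : Ord ℓ} → e ≤ₒ 𝟘 → ω^ e ≤ₒ sucₒ 𝟘
ω^-≤-1 {e = lsub _ _} e≤𝟘 nothing = lift zero , ≤ₒ-refl
ω^-≤-1 {e = lsub _ _} e≤𝟘 (just (i , _)) with e≤𝟘 i
... | lift () , _

-- As `e` is positive, one lies below `ω^ e`, and closure under natural sums gives the successor.
sucₒ<ω^ : ∀ (em : EM) {e ξ : Ord ℓ} → 𝟘 <ₒ e → ξ <ₒ ω^ e → sucₒ ξ <ₒ ω^ e
sucₒ<ω^ em {e} {ξ} 0<e ξ< = ≤ₒ-<ₒ-trans {β = ξ ⊕ sucₒ 𝟘}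
  (λ _ → ≤ₒ-<ₒ-trans α≤α⊕β (⊕-monoʳ-< {β = 𝟘} <sucₒ))
  (ω^-Closed em e ξ< (≤ₒ-<ₒ-trans (λ _ → 𝟘<ω^) (ω^<ω^ 0<e)))

module _ (em : EM) where

  place-cancel-≤ : ∀ (f : Fin l → Ord ℓ) j {ρ σ} → place f j ρ ≤ₒ place f j σ → ρ ≤ₒ σ
  place-cancel-≤ f zero    p = p
  place-cancel-≤ f (suc j) p = place-cancel-≤ (f ∘ suc) j (+-cancelˡ-≤ em (f zero) p)

  -- The summands are subtracted from the left until the remainder fits into the next one.
  locate : ∀ (f : Fin l → Ord ℓ) {ξ} → ξ <ₒ ∑ f → ∃₂ λ j ρ → ρ <ₒ f j × ξ ≈ₒ place f j ρ
  locate {l = zero}  f (lift () , _)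
  locate {l = suc l} f {ξ} ξ< with ≤ₒ-or->ₒ em (f zero) ξ
  ... | inj₂ ξ<f₀ = zero , ξ , ξ<f₀ , ≤ₒ-refl , ≤ₒ-refl
  ... | inj₁ f₀≤ξ with +-subtract em f₀≤ξ
  ...   | σ , ξ≈ with ≤ₒ-or->ₒ em (∑ (f ∘ suc)) σ
  ...     | inj₁ ≤σ = ⊥-elim (<ₒ-irrefl
    (<ₒ-≤ₒ-trans ξ< (≤ₒ-trans (+-monoʳ-≤ {α = f zero} ≤σ) (proj₂ ξ≈))))
  ...     | inj₂ σ< =
    let (j , ρ , ρ< , σ≈) = locate (f ∘ suc) σ<
    in suc j , ρ , ρ< , ≤ₒ-trans (proj₁ ξ≈) (+-monoʳ-≤ (proj₁ σ≈))
                      , ≤ₒ-trans (+-monoʳ-≤ (proj₂ σ≈)) (proj₂ ξ≈)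

-- Incomparability in products

  module _ {α : Fin n → Ord ℓ} where
    private
      _⊥_ : Rel (Tuple α) ℓ
      _⊥_ = Incomparable (product em α)

    ≰⇒∃> : ∀ {x y : Tuple α} → ¬ (∀ i → proj₁ (x i) ≤ₒ proj₁ (y i)) →
           ∃[ i ] proj₁ (y i) <ₒ proj₁ (x i)
    ≰⇒∃> {x} {y} ¬≤ with ¬∀⟶∃¬ n (λ i → proj₁ (x i) ≤ₒ proj₁ (y i)) (λ i → em) ¬≤
    ... | i , xᵢ≰yᵢ with ≤ₒ-or->ₒ em (proj₁ (x i)) (proj₁ (y i))
    ...   | inj₁ x≤y = ⊥-elim (xᵢ≰yᵢ x≤y)
    ...   | inj₂ y<x = i , y<x

    ∃<×∃>⇒⊥ : ∀ {x y} → ∃[ i ] proj₁ (x i) <ₒ proj₁ (y i) → ∃[ j ] proj₁ (y j) <ₒ proj₁ (x j) → x ⊥ y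
    ∃<×∃>⇒⊥ (i , x<y) (j , y<x) =
      (λ x≤y → <ₒ-irrefl (<ₒ-≤ₒ-trans y<x (x≤y j))) ,
      (λ y≤x → <ₒ-irrefl (<ₒ-≤ₒ-trans x<y (y≤x i)))

  reflecting⇒⊥ : ∀ {α γ : Fin n → Ord ℓ} {x y : Tuple α} (x′ y′ : Tuple γ) →
    (∀ i → proj₁ (x′ i) ≤ₒ proj₁ (y′ i) → proj₁ (x i) ≤ₒ proj₁ (y i)) →
    (∀ i → proj₁ (y′ i) ≤ₒ proj₁ (x′ i) → proj₁ (y i) ≤ₒ proj₁ (x i)) →
    Incomparable (product em α) x y → Incomparable (product em γ) x′ y′
  reflecting⇒⊥ _ _ p q (x≰y , y≰x) = (λ x′≤y′ → x≰y λ i → p i (x′≤y′ i)) , (λ y′≤x′ → y≰x λ i → q i (y′≤x′ i))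

  width-product-mono : ∀ {α γ : Fin n → Ord ℓ} → (∀ i → α i ≤ₒ γ i) →
                       width (product em α) em ≤ₒ width (product em γ) em
  width-product-mono {α = α} {γ} α≤γ =
    simulation em (product em α) (product em γ)
      (λ x i → proj₁ (x i) , <ₒ-≤ₒ-trans (proj₂ (x i)) (α≤γ i))
      id (λ _ → []) [] []

  private
    cutoff : (θ μ η : Ord ℓ) → Ord ℓ
    cutoff θ μ η with em {P = η <ₒ θ}
    ... | yes _ = η
    ... | no  _ = μ +ₒ η

    cutoff-below : ∀ {θ} (μ : Ord ℓ) {η} → η <ₒ θ → cutoff θ μ η ≤ₒ η
    cutoff-below {θ = θ} μ {η} η<θ with em {P = η <ₒ θ}
    ... | yes _ = ≤ₒ-refl
    ... | no  p = ⊥-elim (p η<θ)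

    cutoff-above : ∀ {θ} (μ : Ord ℓ) {η} → θ <ₒ η → μ <ₒ cutoff θ μ η
    cutoff-above {θ = θ} μ {η} θ<η with em {P = η <ₒ θ}
    ... | yes p = ⊥-elim (<ₒ-irrefl (<ₒ-trans p θ<η))
    ... | no  _ = α<α+β (≤ₒ-<ₒ-trans 𝟘≤ θ<η)

    cutoff-closed : ∀ {w θ μ η : Ord ℓ} → Closed w → μ <ₒ w → η <ₒ w → cutoff θ μ η <ₒ w
    cutoff-closed {θ = θ} {η = η} c μ< η< with em {P = η <ₒ θ}
    ... | yes _ = η<
    ... | no  _ = Closed⇒+ c μ< η<

    -- Across the threshold, the pushed ordinal `μ +ₒ η` is still at least `η`, so it cannot fall to
    -- an ordinal below `θ`.
    cutoff-cancel-≤ : ∀ (θ μ : Ord ℓ) {η ζ} → cutoff θ μ η ≤ₒ cutoff θ μ ζ → η ≤ₒ ζ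
    cutoff-cancel-≤ θ μ {η} {ζ} p with em {P = η <ₒ θ} | em {P = ζ <ₒ θ}
    ... | yes _   | yes _   = p
    ... | no _    | no _    = +-cancelˡ-≤ em μ p
    ... | yes η<θ | no ζ≮θ  = ≤ₒ-trans (<ₒ⇒≤ₒ η<θ) (≮⇒≥ em ζ≮θ)
    ... | no η≮θ  | yes ζ<θ =
      ⊥-elim (η≮θ (≤ₒ-<ₒ-trans (≤ₒ-trans (β≤α+β {α = μ}) p) ζ<θ))

  -- After any antichain played above x, the elements incomparable to x still embed in the
  -- rest: keep the coordinates below those of x and push the others beyond everything played.
  width-indecomposable : ∀ {w : Fin n → Ord ℓ} → (∀ i → Closed (w i)) → (∀ i → 𝟘 <ₒ w i) →
    ∀ {γ} → γ <ₒ width (product em w) em → γ +ₒ width (product em w) em ≤ₒ width (product em w) em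
  width-indecomposable {n = n} {w = w} c 𝟘<w {γ} γ< with rk-<-inv em (product em w) [] [] γ<
  ... | x , x⊥ , γ≤ = ≤ₒ-trans (+-monoˡ-≤ γ≤)
    -- `shift` first plays a full copy of the product above `x`; by `base` the rank left after
    -- playing only `x` is still available.
    (sum-simulation em P P shift
      (λ {y} {z} → reflecting⇒⊥ {x = y} {z} (shift y) (shift z)
        (λ i → +-cancelˡ-≤ em _) (λ i → +-cancelˡ-≤ em _))
      (λ _ → []) base [] [])
    where
    P = product em w

    shift : Tuple w → Tuple w
    shift y i = proj₁ (x i) +ₒ proj₁ (y i) , Closed⇒+ (c i) (proj₂ (x i)) (proj₂ (y i))

    base : ∀ u q → rk em P [ x ] (x⊥ ∷ []) ≤ₒ rk em P (map shift u ++ []) q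
    base u q = simulation em P P push
      (λ {y} {z} → reflecting⇒⊥ {x = y} {z} (push y) (push z)
        (λ i → cutoff-cancel-≤ _ _) (λ i → cutoff-cancel-≤ _ _))
      (λ {y} → push-⊥ {y}) (x⊥ ∷ []) q
      where
      G : List (Tuple w)
      G = map shift u ++ []

      above-x : All (λ z → ∀ i → proj₁ (x i) ≤ₒ proj₁ (z i)) G
      above-x = All.++⁺ (All.map⁺ (All.tabulate λ _ i → α≤α+β)) []

      bound : ∀ i → ∃[ μ ] μ <ₒ w i × All (λ z → proj₁ (z i) ≤ₒ μ) G
      bound i = Closed-bound (c i) (𝟘<w i) (λ z → proj₁ (z i)) (λ z → proj₂ (z i)) G

      push : Tuple w → Tuple w
      push y i = cutoff (proj₁ (x i)) (proj₁ (bound i)) (proj₁ (y i)) ,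
                 cutoff-closed (c i) (proj₁ (proj₂ (bound i))) (proj₂ (y i))

      push-⊥ : ∀ {y} → All (Incomparable P y) [ x ] → All (Incomparable P (push y)) G
      push-⊥ {y} ((y≰x , x≰y) ∷ []) = All.tabulate λ {z} z∈G →
        -- Coordinate `i` is kept and stays below `z`, which lies above `x`; coordinate `j` is
        -- pushed beyond the bound for `G`.
        let (i , yᵢ<xᵢ) = ≰⇒∃> {x = x} {y} x≰y
            (j , xⱼ<yⱼ) = ≰⇒∃> {x = y} {x} y≰x
        in ∃<×∃>⇒⊥ {x = push y} {z}
             (i , ≤ₒ-<ₒ-trans (cutoff-below (proj₁ (bound i)) yᵢ<xᵢ)
                              (<ₒ-≤ₒ-trans yᵢ<xᵢ (All.lookup above-x z∈G i)))
             (j , ≤ₒ-<ₒ-trans (All.lookup (proj₂ (proj₂ (bound j))) z∈G)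
                              (cutoff-above (proj₁ (bound j)) xⱼ<yⱼ))

-- Slices

_≼_ : {l : Fin n → ℕ} → Rel (Slice l) 0ℓ
s ≼ t = ∀ i → s i Fin.≤ t i

AllPairs-cartesianProductWith : ∀ {A B C : Set} {R : Rel A a} {S : Rel B a} {T : Rel C a} (f : A → B → C) →
  (∀ {x x′ y y′} → R x x′ → T (f x y) (f x′ y′)) → (∀ {x y y′} → S y y′ → T (f x y) (f x y′)) →
  ∀ {xs ys} → AllPairs R xs → AllPairs S ys → AllPairs T (cartesianProductWith f xs ys)
AllPairs-cartesianProductWith f R⇒T S⇒T [] qs = []
AllPairs-cartesianProductWith f R⇒T S⇒T {x ∷ xs} {ys} (p ∷ ps) qs = AllPairs.++⁺
  (AllPairs.map⁺ (AllPairs.map S⇒T qs))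
  (AllPairs-cartesianProductWith f R⇒T S⇒T ps qs)
  (All.map⁺ (All.tabulate λ _ →
    All.cartesianProductWith⁺ (≡.setoid _) (≡.setoid _) f xs ys λ x′∈ _ → R⇒T (All.lookup p x′∈)))

-- The enumeration is lexicographic without repetitions, and the lexicographic order extends the
-- componentwise one.
Sl-ordered : (l : Fin n → ℕ) → AllPairs (λ s t → ¬ t ≼ s) (Sl l)
Sl-ordered {n = zero}  l = [] ∷ []
Sl-ordered {n = suc n} l = AllPairs-cartesianProductWith ∀-cons
  (λ j<k k≼j → ℕ.<⇒≱ j<k (k≼j zero)) (λ t⋠s t≼s → t⋠s (t≼s ∘ suc))
  (AllPairs.tabulate⁺-< (λ j<k → j<k)) (Sl-ordered (l ∘ suc))

Sl-complete : ∀ {l : Fin n → ℕ} (s : Slice l) → Any (λ t → ∀ i → t i ≡ s i) (Sl l)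
Sl-complete {n = zero}  s = here λ ()
Sl-complete {n = suc n} s = Any.cartesianProductWith⁺ ∀-cons
  (λ p q → ∀-cons (sym p) q) (∈-allFin (s zero)) (Sl-complete (s ∘ suc))

Gr-complete : ∀ {l : Fin n → ℕ} {s : Slice l} → Grounded s → Any (λ t → ∀ i → t i ≡ s i) (Gr l)
Gr-complete {l = l} {s} (k , sₖ≡0) with Any.filter⁺ (grounded? {l = l}) (Sl-complete s)
... | inj₁ p  = p
... | inj₂ ¬p = ⊥-elim (¬p (k , trans (cong toℕ (Any.lookup-result (Sl-complete s) k)) sₖ≡0))

toℕ-pred : ∀ (j : Fin n) → ¬ toℕ j ≡ 0 → toℕ j ≡ suc (toℕ (Fin.pred j))
toℕ-pred zero    j≢0 = ⊥-elim (j≢0 refl)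
toℕ-pred (suc j) _   = cong suc (sym (toℕ-inject₁ j))

-- All coordinates are lowered together until one vanishes, and `m` counts the steps. Coordinate
-- `zero` bounds their number, hence the dimension `suc n`.
descend : ∀ {l : Fin (suc n) → ℕ} (s : Slice l) →
          ∃₂ λ m (t : Slice l) → Grounded t × ∀ i → toℕ (s i) ≡ m ℕ.+ toℕ (t i)
descend {l = l} s = go (toℕ (s zero)) s ℕ.≤-refl
  where
  go : ∀ k (s : Slice l) → toℕ (s zero) ℕ.≤ k →
       ∃₂ λ m (t : Slice l) → Grounded t × ∀ i → toℕ (s i) ≡ m ℕ.+ toℕ (t i)
  go k s s≤k with grounded? {l = l} s
  ... | yes g = 0 , s , g , λ _ → refl
  go zero    s s≤k | no ¬g = ⊥-elim (¬g (zero , ℕ.n≤0⇒n≡0 s≤k))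
  go (suc k) s s≤k | no ¬g =
    let (m , t , g , eq) = go k (Fin.pred ∘ s)
          (ℕ.s≤s⁻¹ (subst (ℕ._≤ suc k) (toℕ-pred (s zero) (λ p → ¬g (zero , p))) s≤k))
    in suc m , t , g , λ i → trans (toℕ-pred (s i) (λ p → ¬g (i , p))) (cong suc (eq i))

-- Sorting by W; among equals, x comes before y only if ¬ x ≲ y.
module _ (em : EM) {A : Set} (W : A → Ord ℓ) (_≲_ : Rel A 0ℓ)
         (anti : ∀ {x y} → x ≲ y → W y ≤ₒ W x) where
  private
    Q : Rel A _
    Q x y = W x ≤ₒ W y × ¬ x ≲ y

    -- In the recursive call of `sort`, the list `zs` holds the elements that originally came after
    -- `x`.
    insert : ∀ x zs → All (λ z → ¬ z ≲ x) zs → AllPairs Q zs →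
             ∃[ ys ] x ∷ zs ↭ ys × AllPairs Q ys
    insert x []       _        _          = [ x ] , ↭-refl , [] ∷ []
    insert x (z ∷ zs) (p ∷ ps) (q ∷ qs) with ≤ₒ-or->ₒ em (W z) (W x)
    -- Ties also move `x` behind `z`, so the given order is reversed among equals, as `¬ z ≲ x`
    -- permits.
    ... | inj₁ Wz≤Wx =
      let (ys , perm , ss) = insert x zs ps qs
      in z ∷ ys , ↭-trans (↭-swap x z ↭-refl) (prep z perm) , All-resp-↭ perm ((Wz≤Wx , p) ∷ q) ∷ ss
    ... | inj₂ Wx<Wz = x ∷ z ∷ zs , ↭-refl ,
      (before ≤ₒ-refl ∷ All.map (before ∘ proj₁) q) ∷ q ∷ qs
      where
      before : ∀ {y} → W z ≤ₒ W y → Q x y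
      before Wz≤Wy = <ₒ⇒≤ₒ (<ₒ-≤ₒ-trans Wx<Wz Wz≤Wy) ,
        λ x≲y → <ₒ-irrefl (<ₒ-≤ₒ-trans Wx<Wz (≤ₒ-trans Wz≤Wy (anti x≲y)))

  sort : ∀ xs → AllPairs (λ x y → ¬ y ≲ x) xs →
         ∃[ ys ] xs ↭ ys × AllPairs (λ x y → W x ≤ₒ W y × ¬ x ≲ y) ys
  sort []       []       = [] , ↭-refl , []
  sort (x ∷ xs) (p ∷ ps) =
    let (zs , perm , qs)  = sort xs ps
        (ys , perm′ , ss) = insert x zs (All-resp-↭ perm p) qs
    in ys , ↭-trans (prep x perm) perm′ , ss

⨁-↭ : ∀ {xs ys : List (Ord ℓ)} → xs ↭ ys → ⨁ xs ≤ₒ ⨁ ys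
⨁-↭ Perm.refl             = ≤ₒ-refl
⨁-↭ (Perm.prep x p)       = ⊕-monoʳ-≤ (⨁-↭ p)
⨁-↭ (Perm.swap {xs} {ys} x y p) = begin
  x ⊕ (y ⊕ ⨁ xs) ≤⟨ ⊕-assocˡ x y (⨁ xs) ⟩
  x ⊕ y ⊕ ⨁ xs   ≤⟨ ⊕-mono-≤ (⊕-comm x y) (⨁-↭ p) ⟩
  y ⊕ x ⊕ ⨁ ys   ≤⟨ ⊕-assocʳ y x (⨁ ys) ⟩
  y ⊕ (x ⊕ ⨁ ys) ∎
  where open ≤ₒ-Reasoning
⨁-↭ (Perm.trans p q)      = ≤ₒ-trans (⨁-↭ p) (⨁-↭ q)

-- Locating tuples in slices, and the upper bound

module _ (em : EM) {ℓ n} (α : Fin n → Ord ℓ) (l : Fin n → ℕ) (β : ∀ i → Fin (l i) → Ord ℓ)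
         (cnf : ∀ i → IsCNF (α i) (β i)) where
  private
    X : WQO (lsuc ℓ) ℓ ℓ
    X = product em α

    f : ∀ i → Fin (l i) → Ord ℓ
    f i j = ω^ β i j

    B : Slice l → WQO (lsuc ℓ) ℓ ℓ
    B s = product em λ i → f i (s i)

    W : Slice l → Ord (lsuc ℓ)
    W s = width (B s) em

    f-antitone : ∀ i {j k} → j Fin.≤ k → f i k ≤ₒ f i j
    f-antitone i j≤k = ω^-mono-≤ (IsCNF.nonincreasing (cnf i) j≤k)

    -- Membership of `x` in the slice `s` with remainders `ρ`, up to `≈ₒ` because coordinates are
    -- codes.
    record At (x : Tuple α) (s : Slice l) (ρ : ∀ i → Below (f i (s i))) : Set ℓ where
      constructor at
      field coordinate : ∀ i → proj₁ (x i) ≈ₒ place (f i) (s i) (proj₁ (ρ i))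

    located : ∀ x → ∃₂ λ s ρ → At x s ρ
    located x = (λ i → proj₁ (loc i)) ,
                (λ i → proj₁ (proj₂ (loc i)) , proj₁ (proj₂ (proj₂ (loc i)))) ,
                at (λ i → proj₂ (proj₂ (proj₂ (loc i))))
      where loc = λ i → locate em (f i) (<ₒ-≤ₒ-trans (proj₂ (x i)) (proj₁ (IsCNF.sum (cnf i))))

    At-< : ∀ {x y s t ρ σ} → At x s ρ → At y t σ → ∀ i → s i Fin.< t i → proj₁ (x i) <ₒ proj₁ (y i)
    At-< {s = s} {t} {ρ} {σ} (at x∈) (at y∈) i s<t = ≤ₒ-<ₒ-trans (proj₁ (x∈ i))
      (<ₒ-≤ₒ-trans (place-<-place (f i) (proj₁ (σ i)) s<t (proj₂ (ρ i))) (proj₂ (y∈ i)))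

    At-≤ : ∀ {x y s t ρ σ} → At x s ρ → At y t σ → ∀ i → s i ≡ t i →
           proj₁ (ρ i) ≤ₒ proj₁ (σ i) → proj₁ (x i) ≤ₒ proj₁ (y i)
    At-≤ {x} {s = s} {ρ = ρ} {σ} (at x∈) (at y∈) i s≡t ρ≤σ = ≤ₒ-trans (proj₁ (x∈ i))
      (≤ₒ-trans (place-monoʳ-≤ (f i) (s i) ρ≤σ)
                (subst (λ j → place (f i) j (proj₁ (σ i)) ≤ₒ _) (sym s≡t) (proj₂ (y∈ i))))

  width-≤ : 1 ℕ.≤ n → width X em ≤ₒ ⨁ (map W (Gr l))
  width-≤ (s≤s _) = width-≤-⨁ em B X g g-#
    where
    module _ (x : Tuple α) where
      s   = proj₁ (located x)
      ρ   = proj₁ (proj₂ (located x))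
      x∈  = proj₂ (proj₂ (located x))
      m   = proj₁ (descend s)
      t   = proj₁ (proj₂ (descend s))
      t-g = proj₁ (proj₂ (proj₂ (descend s)))
      s≡  = proj₂ (proj₂ (proj₂ (descend s)))

      -- `Gr-complete` supplies a slice `u` only pointwise equal to `t`. The remainders fit there
      -- since `u i` is at most `s i` and the powers do not increase.
      embed : ∀ {u : Slice l} → (∀ i → u i ≡ t i) → WQO.Carrier (B u)
      embed u≡t i = proj₁ (ρ i) , <ₒ-≤ₒ-trans (proj₂ (ρ i)) (f-antitone i
        (ℕ.≤-trans (ℕ.≤-reflexive (cong toℕ (u≡t i)))
                   (ℕ.≤-trans (ℕ.m≤n+m _ m) (ℕ.≤-reflexive (sym (s≡ i))))))

    g : ∀ x → Any (WQO.Carrier ∘ B) (Gr l)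
    g x = Any.map (λ {u} → embed x {u}) (Gr-complete (t-g x))

    s≡m+ : ∀ x {u} → (∀ i → u i ≡ t x i) → ∀ i → toℕ (s x i) ≡ m x ℕ.+ toℕ (u i)
    s≡m+ x u≡t i = trans (s≡ x i) (cong (λ j → m x ℕ.+ toℕ j) (sym (u≡t i)))

    s-mono-< : ∀ x y {u} → (∀ i → u i ≡ t x i) → (∀ i → u i ≡ t y i) →
               m x ℕ.< m y → ∀ i → s x i Fin.< s y i
    s-mono-< x y {u} p q m< i = subst₂ ℕ._<_ (sym (s≡m+ x {u} p i)) (sym (s≡m+ y {u} q i))
      (ℕ.+-monoˡ-< (toℕ (u i)) m<)

    -- Different `m` on one diagonal would make `x` and `y` comparable; equal `m` puts them into the
    -- same slice, where the remainders decide.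
    embed-≰ : ∀ x y {u} → (∀ i → u i ≡ t x i) → (∀ i → u i ≡ t y i) →
              Incomparable X x y → ¬ (∀ i → proj₁ (ρ x i) ≤ₒ proj₁ (ρ y i))
    embed-≰ x y {u} p q (x≰y , y≰x) ρ≤ with ℕ.<-cmp (m x) (m y)
    ... | tri< m< _ _ = x≰y λ i → <ₒ⇒≤ₒ (At-< (x∈ x) (x∈ y) i (s-mono-< x y {u} p q m< i))
    ... | tri> _ _ m> = y≰x λ i → <ₒ⇒≤ₒ (At-< (x∈ y) (x∈ x) i (s-mono-< y x {u} q p m> i))
    ... | tri≈ _ m≡ _ = x≰y λ i → At-≤ (x∈ x) (x∈ y) i (toℕ-injective
            (trans (s≡m+ x {u} p i) (trans (cong (ℕ._+ toℕ (u i)) m≡) (sym (s≡m+ y {u} q i))))) (ρ≤ i)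

    g-# : ∀ {x y} → Incomparable X x y → _#_ em B (g x) (g y)
    g-# {x} {y} x⊥y = Any-map-# em B (λ {u} → embed x {u}) (λ {u} → embed y {u})
      (λ {u} p q → embed-≰ x y {u} p q x⊥y , embed-≰ y x {u} q p (swap x⊥y))
      (Gr-complete (t-g x)) (Gr-complete (t-g y))

  -- Lower bound by successive copies of slices

  module _ (ω≤α : ∀ i → ω ≤ₒ α i) where
    private
      -- A vanishing leading exponent forces all exponents to vanish, so `α i` would be finite.
      𝟘<leading : ∀ i {j} → toℕ j ≡ 0 → 𝟘 <ₒ β i j
      𝟘<leading i {j} j≡0 with ≤ₒ-or->ₒ em (β i j) 𝟘
      ... | inj₂ p   = p
      ... | inj₁ β≤𝟘 = ⊥-elim (<ₒ-irrefl (finite (lift (l i))))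
        where
        finite : ω ≤ₒ fromℕ (l i)
        finite = ≤ₒ-trans (ω≤α i) (≤ₒ-trans (proj₁ (IsCNF.sum (cnf i))) (∑-≤-fromℕ (f i) λ k →
          ω^-≤-1 (≤ₒ-trans (IsCNF.nonincreasing (cnf i) (subst (ℕ._≤ toℕ k) (sym j≡0) z≤n)) β≤𝟘)))

      InGr : Tuple α → Slice l → Set (lsuc ℓ)
      InGr z a = Grounded a × ∃[ ρ ] At z a ρ

      -- A copy of B b inside X, shifted beyond the coordinates of G in those ω^ β i (b i)
      -- that are limits.
      module Copy (b : Slice l) (G : List (Tuple α)) where
        -- Where the successor does not fit into the power, the default `𝟘` keeps the common bound
        -- inside it.
        next : ∀ i → Tuple α → Ord ℓ
        next i z with em {P = sucₒ (proj₁ (z i)) <ₒ f i (b i)}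
        ... | yes _ = sucₒ (proj₁ (z i))
        ... | no  _ = 𝟘

        next< : ∀ i z → next i z <ₒ f i (b i)
        next< i z with em {P = sucₒ (proj₁ (z i)) <ₒ f i (b i)}
        ... | yes p = p
        ... | no  _ = 𝟘<ω^

        <next : ∀ i z → sucₒ (proj₁ (z i)) <ₒ f i (b i) → proj₁ (z i) <ₒ next i z
        <next i z s< with em {P = sucₒ (proj₁ (z i)) <ₒ f i (b i)}
        ... | yes _ = <sucₒ
        ... | no ¬p = ⊥-elim (¬p s<)

        bound : ∀ i → ∃[ μ ] μ <ₒ f i (b i) × All (λ z → next i z ≤ₒ μ) G
        bound i = Closed-bound (ω^-Closed em (β i (b i))) 𝟘<ω^ (next i) (next< i) G

        offset : WQO.Carrier (B b) → ∀ i → Below (f i (b i))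
        offset y i = proj₁ (bound i) +ₒ proj₁ (y i) ,
          Closed⇒+ (ω^-Closed em (β i (b i))) (proj₁ (proj₂ (bound i))) (proj₂ (y i))

        copy : WQO.Carrier (B b) → Tuple α
        copy y i = place (f i) (b i) (proj₁ (offset y i)) ,
          <ₒ-≤ₒ-trans (place<∑ (f i) (b i) (proj₂ (offset y i))) (proj₂ (IsCNF.sum (cnf i)))

        copy-At : ∀ y → At (copy y) b (offset y)
        copy-At y = at λ i → ≤ₒ-refl , ≤ₒ-refl

        copy-⊥ : ∀ {x y} → Incomparable (B b) x y → Incomparable X (copy x) (copy y)
        copy-⊥ {x} {y} = reflecting⇒⊥ em {x = x} {y} (copy x) (copy y)
          (λ i p → +-cancelˡ-≤ em _ (place-cancel-≤ em (f i) (b i) p))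
          (λ i p → +-cancelˡ-≤ em _ (place-cancel-≤ em (f i) (b i) p))

        -- If `b k` is positive, the copy lies in a later block of coordinate `k`. Otherwise both
        -- points lie in the leading block, a limit, and the shift has passed `z`.
        copy-> : ∀ y {z a ρ} → z ∈ G → At z a ρ → ∀ k → toℕ (a k) ≡ 0 → proj₁ (z k) <ₒ proj₁ (copy y k)
        copy-> y {z} {a} {ρ} z∈G z∈ k aₖ≡0 with toℕ (b k) ℕ.≟ 0
        ... | no bₖ≢0 = At-< z∈ (copy-At y) k
          (subst (ℕ._< toℕ (b k)) (sym aₖ≡0) (ℕ.n≢0⇒n>0 bₖ≢0))
        ... | yes bₖ≡0 = begin-strict
          proj₁ (z k)                        <⟨ <next k z (sucₒ<ω^ em (𝟘<leading k bₖ≡0) zₖ<) ⟩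
          next k z                           ≤⟨ All.lookup (proj₂ (proj₂ (bound k))) z∈G ⟩
          proj₁ (bound k)                    ≤⟨ α≤α+β ⟩
          proj₁ (bound k) +ₒ proj₁ (y k)     ≤⟨ ρ≤place (f k) (b k) ⟩
          proj₁ (copy y k)                   ∎
          where
          zₖ< : proj₁ (z k) <ₒ f k (b k)
          zₖ< = begin-strict
            proj₁ (z k)                     ≤⟨ proj₁ (At.coordinate z∈ k) ⟩
            place (f k) (a k) (proj₁ (ρ k)) ≡⟨ place-first (f k) (a k) aₖ≡0 ⟩
            proj₁ (ρ k)                     <⟨ proj₂ (ρ k) ⟩
            f k (a k)                       ≡⟨ cong (f k) (toℕ-injective (trans aₖ≡0 (sym bₖ≡0))) ⟩
            f k (b k)                       ∎

    -- The head `b` is the last summand and is played first. Its copy adds only points of slice `b`,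
    -- which is not `≼` any remaining slice, so the condition on `G` persists.
    revSum-≤-rk : ∀ L → All Grounded L → AllPairs (λ a b → ¬ a ≼ b) L →
                  ∀ G q → All (λ z → ∃[ a ] InGr z a × All (λ b → ¬ a ≼ b) L) G →
                  revSum (map W L) ≤ₒ rk em X G q
    revSum-≤-rk []      _          _        G q inG = 𝟘≤
    revSum-≤-rk (b ∷ L) (gb ∷ gL) (p ∷ ps) G q inG =
      sum-simulation em (B b) X copy (λ {x} {y} → copy-⊥ {x} {y})
        (λ {y} _ → All.tabulate λ z∈G → copy-⊥-G y z∈G (All.lookup inG z∈G))
        (λ u q′ → revSum-≤-rk L gL ps (map copy u ++ G) q′ (All.++⁺
          (All.map⁺ (All.tabulate λ {y} _ → b , (gb , offset y , copy-At y) , p))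
          (All.map (λ { (a , z∈ , _ ∷ a⋠) → a , z∈ , a⋠ }) inG)))
        [] q
      where
      open Copy b G

      copy-⊥-G : ∀ y {z} → z ∈ G → ∃[ a ] InGr z a × All (λ b′ → ¬ a ≼ b′) (b ∷ L) →
                 Incomparable X (copy y) z
      copy-⊥-G y {z} z∈G (a , ((k , aₖ≡0) , ρ , z∈) , a⋠b ∷ _)
        with ¬∀⟶∃¬ n (λ i → a i Fin.≤ b i) (λ i → toℕ (a i) ℕ.≤? toℕ (b i)) a⋠b
      ... | i , aᵢ≰bᵢ = ∃<×∃>⇒⊥ em {x = copy y} {z}
        -- The copy is in an earlier block than `z` at `i`, and is shifted above `z` at the grounded
        -- coordinate `k`.
        (i , At-< (copy-At y) z∈ i (ℕ.≰⇒> aᵢ≰bᵢ)) (k , copy-> y z∈G z∈ k aₖ≡0)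

    ⨁-≤-width : ⨁ (map W (Gr l)) ≤ₒ width X em
    -- For `s ≼ t` the factors of `B t` are at most those of `B s`, which gives the antitonicity
    -- that `sort` asks for.
    ⨁-≤-width with sort em W _≼_ (λ s≼t → width-product-mono em λ i → f-antitone i (s≼t i))
                        (Gr l) (AllPairs.filter⁺ grounded? (Sl-ordered l))
    ... | L , Gr↭L , sorted =
      ≤ₒ-trans (⨁-↭ (↭-map⁺ W Gr↭L))
      (≤ₒ-trans (⨁≤revSum em (All.map⁺ (All.tabulate λ _ → W-Closed)) (AllPairs.map⁺ (AllPairs.map proj₁ sorted)))
                (revSum-≤-rk L (All-resp-↭ Gr↭L (All.all-filter grounded? (Sl l)))
                             (AllPairs.map proj₂ sorted) [] [] []))
      where
      W-Closed : ∀ {s} → Closed (W s)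
      W-Closed {s} = indecomposable⇒Closed em
        (width-indecomposable em (λ i → ω^-Closed em (β i (s i))) (λ i → 𝟘<ω^))

mainTheorem11 : (em : EM) {ℓ : Level} {n : ℕ} → 1 ≤ n →
    (α : Fin n → Ord ℓ) → (∀ i → ω ≤ₒ α i) →
    (l : Fin n → ℕ) (β : ∀ i → Fin (l i) → Ord ℓ) → (∀ i → IsCNF (α i) (β i)) →
    width (product em α) em ≈ₒ ⨁ (map (λ s → width (product em λ i → ω^ β i (s i)) em) (Gr l))
mainTheorem11 em 1≤n α ω≤α l β cnf = width-≤ em α l β cnf 1≤n , ⨁-≤-width em α l β cnf ω≤α
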